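{- Let ALG be any (possibly randomized) algorithm for online facility location with uniform facility cost. Then the random-order competitive ratio of ALG is at least $2-o(1)$; that is, there are instances $\mathcal{I}_n=(M_n,d_n,U_n)$ with $|U_n|=n$, $n=1,2,\dots$, such that $\mathrm{E}[\mathrm{ALG}(\mathcal{I}_n)]\ge(2-o(1))\cdot\mathrm{OPT}(\mathcal{I}_n)$ as $n\to\infty$.
   Context: Facility location: an instance is $\mathcal{I}=(M,d,U)$, where $(M,d)$ is a metric space (given to the algorithm) and $U$ is a multiset of $n$ demand points in $M$ (copies are treated as distinct demands). A facility may be opened at any point of $M$ at cost $1$. For $F\subseteq M$, $d(F,v)=\min_{u\in F}d(u,v)$, $d(\emptyset,v)=\infty$. $\mathrm{OPT}(\mathcal{I})$ is the minimum over $F\subseteq M$ of $|F|+\sum_{v\in U}d(F,v)$. Random-order online model: the demands arrive one by one as a uniformly random permutation $v_1,\dots,v_n$ of $U$. When $v_\ell$ arrives the algorithm immediately and irrevocably decides whether and where to open new facilities, and then $v_\ell$ is irrevocably assigned to its nearest open facility. With $F_\ell$ the set of facilities opened by the end of round $\ell$, the algorithm's cost is $\mathrm{ALG}(\mathcal{I})=|F_n|+\sum_{\ell=1}^n d(F_\ell,v_\ell)$; expectations are over the arrival order and the internal randomness of the algorithm. ALG is $c$-competitive if $\mathrm{E}[\mathrm{ALG}(\mathcal{I})]\le c\cdot\mathrm{OPT}(\mathcal{I})$ for all $\mathcal{I}$. -}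

module Defs where

open import Level using (0ℓ)
open import Data.Nat.Base as ℕ using (ℕ; zero; suc; _!)
import Data.Nat.Properties as ℕ
open import Data.Integer.Base as ℤ using (+_)
open import Data.Rational.Base as ℚ using (ℚ; 0ℚ; 1ℚ; ½)
import Data.Rational.Properties as ℚ
open import Data.Rational.Solver using (module +-*-Solver)
open import Data.Fin.Base using (Fin)
open import Data.List.Base using (List; []; _∷_; _++_; _∷ʳ_; [_]; map; concatMap; foldr; length; allFin)
open import Data.Product.Base using (∃; ∃-syntax; _×_; _,_)
open import Data.Sum.Base using (inj₁; inj₂)
open import Data.Vec.Functional using (Vector)
open import Function.Metric.Structures using (IsGeneralMetric)
open import Relation.Binary.Core using (Rel)
open import Relation.Binary.PropositionalEquality using (_≡_; refl; sym; cong)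
open import Relation.Nullary.Construct.Add.Supremum using (_⁺; ⊤⁺) renaming ([_] to fin)

------------------------------------------------------------------------
-- Real numbers: Cauchy sequences of rationals (with a modulus of
-- convergence, as the existential is constructive) up to _≃_.

EventuallyWithin : (ℕ → ℚ) → ℚ → Set
EventuallyWithin x ε = ∃[ N ] (∀ m n → N ℕ.≤ m → N ℕ.≤ n → ℚ.∣ x m ℚ.- x n ∣ ℚ.≤ ε)

IsCauchy : (ℕ → ℚ) → Set
IsCauchy x = ∀ ε → 0ℚ ℚ.< ε → EventuallyWithin x ε

record ℝ : Set where
  constructor mkℝ
  field
    seq    : ℕ → ℚ
    cauchy : IsCauchy seq

open ℝ public

infix  4 _≤_ _≃_ _⟶_
infixl 6 _+_ _-_
infixl 7 _*_ _⊓_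

_≤_ : Rel ℝ 0ℓ
x ≤ y = ∀ ε → 0ℚ ℚ.< ε → ∃[ N ] (∀ n → N ℕ.≤ n → seq x n ℚ.≤ seq y n ℚ.+ ε)

_≃_ : Rel ℝ 0ℓ
x ≃ y = x ≤ y × y ≤ x

private
  p≤∣p∣ : ∀ p → p ℚ.≤ ℚ.∣ p ∣
  p≤∣p∣ p with ℚ.≤-total 0ℚ p
  ... | inj₁ 0≤p = ℚ.≤-reflexive (sym (ℚ.0≤p⇒∣p∣≡p 0≤p))
  ... | inj₂ p≤0 = ℚ.≤-trans p≤0 (ℚ.0≤∣p∣ p)

  ∣∣≤⇒≤+ : ∀ {p q ε} → ℚ.∣ p ℚ.- q ∣ ℚ.≤ ε → p ℚ.≤ q ℚ.+ ε
  ∣∣≤⇒≤+ {p} {q} {ε} h = begin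
    p                ≡⟨ solve 2 (λ p q → p := q :+ (p :- q)) refl p q ⟩
    q ℚ.+ (p ℚ.- q)  ≤⟨ ℚ.+-monoʳ-≤ q (ℚ.≤-trans (p≤∣p∣ _) h) ⟩
    q ℚ.+ ε          ∎
    where
    open ℚ.≤-Reasoning
    open +-*-Solver

  ≤+⇒-≤ : ∀ {p q ε} → p ℚ.≤ q ℚ.+ ε → p ℚ.- q ℚ.≤ ε
  ≤+⇒-≤ {p} {q} {ε} h = begin
    p ℚ.- q          ≤⟨ ℚ.+-monoˡ-≤ (ℚ.- q) h ⟩
    q ℚ.+ ε ℚ.- q    ≡⟨ solve 2 (λ q ε → q :+ ε :- q := ε) refl q ε ⟩
    ε                ∎
    where
    open ℚ.≤-Reasoning
    open +-*-Solver

  ≤+⇒∣∣≤ : ∀ {p q ε} → p ℚ.≤ q ℚ.+ ε → q ℚ.≤ p ℚ.+ ε → ℚ.∣ p ℚ.- q ∣ ℚ.≤ ε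
  ≤+⇒∣∣≤ {p} {q} {ε} h k with ℚ.∣p∣≡p∨∣p∣≡-p (p ℚ.- q)
  ... | inj₁ e = ℚ.≤-trans (ℚ.≤-reflexive e) (≤+⇒-≤ h)
  ... | inj₂ e = begin
    ℚ.∣ p ℚ.- q ∣    ≡⟨ e ⟩
    ℚ.- (p ℚ.- q)    ≡⟨ solve 2 (λ p q → :- (p :- q) := q :- p) refl p q ⟩
    q ℚ.- p          ≤⟨ ≤+⇒-≤ k ⟩
    ε                ∎
    where
    open ℚ.≤-Reasoning
    open +-*-Solver

  0<½* : ∀ {ε} → 0ℚ ℚ.< ε → 0ℚ ℚ.< ½ ℚ.* ε
  0<½* {ε} ε>0 = ℚ.positive⁻¹ (½ ℚ.* ε) {{ℚ.pos*pos⇒pos ½ ε {{ℚ.positive ε>0}}}}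

  ½+½ : ∀ ε → ½ ℚ.* ε ℚ.+ ½ ℚ.* ε ≡ ε
  ½+½ = solve 1 (λ ε → con ½ :* ε :+ con ½ :* ε := ε) refl
    where open +-*-Solver

  ⊔ˡ : ∀ {N M k} → N ℕ.⊔ M ℕ.≤ k → N ℕ.≤ k
  ⊔ˡ {N} {M} = ℕ.≤-trans (ℕ.m≤m⊔n N M)

  ⊔ʳ : ∀ {N M k} → N ℕ.⊔ M ℕ.≤ k → M ℕ.≤ k
  ⊔ʳ {N} {M} = ℕ.≤-trans (ℕ.m≤n⊔m N M)

  Bounded : (ℕ → ℚ) → Set
  Bounded x = ∃[ B ] 0ℚ ℚ.< B × ∃[ N ] (∀ n → N ℕ.≤ n → ℚ.∣ x n ∣ ℚ.≤ B)

  eventually-bounded : ∀ x → Bounded (seq x)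
  eventually-bounded x =
    let (N , c) = cauchy x 1ℚ (ℚ.positive⁻¹ 1ℚ)
        a       = seq x N
    in ℚ.∣ a ∣ ℚ.+ 1ℚ
     , ℚ.<-≤-trans (ℚ.positive⁻¹ 1ℚ)
         (ℚ.≤-trans (ℚ.≤-reflexive (sym (ℚ.+-identityˡ 1ℚ))) (ℚ.+-monoˡ-≤ 1ℚ (ℚ.0≤∣p∣ a)))
     , N
     , λ n N≤n → begin
         ℚ.∣ seq x n ∣                        ≡⟨ cong ℚ.∣_∣ (solve 2 (λ p q → p := q :+ (p :- q)) refl (seq x n) a) ⟩
         ℚ.∣ a ℚ.+ (seq x n ℚ.- a) ∣          ≤⟨ ℚ.∣p+q∣≤∣p∣+∣q∣ a _ ⟩
         ℚ.∣ a ∣ ℚ.+ ℚ.∣ seq x n ℚ.- a ∣      ≤⟨ ℚ.+-monoʳ-≤ ℚ.∣ a ∣ (c n N N≤n ℕ.≤-refl) ⟩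
         ℚ.∣ a ∣ ℚ.+ 1ℚ                       ∎
    where
    open ℚ.≤-Reasoning
    open +-*-Solver

  +-interchange : ∀ a b c d → a ℚ.+ b ℚ.- (c ℚ.+ d) ≡ (a ℚ.- c) ℚ.+ (b ℚ.- d)
  +-interchange = solve 4 (λ a b c d → a :+ b :- (c :+ d) := (a :- c) :+ (b :- d)) refl
    where open +-*-Solver

  neg-sub : ∀ a b → ℚ.- a ℚ.- (ℚ.- b) ≡ b ℚ.- a
  neg-sub = solve 2 (λ a b → :- a :- (:- b) := b :- a) refl
    where open +-*-Solver

  *-sub : ∀ a a′ e e′ → a ℚ.* e ℚ.- a′ ℚ.* e′ ≡ a ℚ.* (e ℚ.- e′) ℚ.+ e′ ℚ.* (a ℚ.- a′)
  *-sub = solve 4 (λ a a′ e e′ → a :* e :- a′ :* e′ := a :* (e :- e′) :+ e′ :* (a :- a′)) refl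
    where open +-*-Solver

  *-bound : ∀ p q {B δ} → ℚ.∣ p ∣ ℚ.≤ B → ℚ.∣ q ∣ ℚ.≤ δ → ℚ.∣ p ℚ.* q ∣ ℚ.≤ B ℚ.* δ
  *-bound p q {B} {δ} p≤B q≤δ = begin
    ℚ.∣ p ℚ.* q ∣          ≡⟨ ℚ.∣p*q∣≡∣p∣*∣q∣ p q ⟩
    ℚ.∣ p ∣ ℚ.* ℚ.∣ q ∣    ≤⟨ ℚ.*-monoʳ-≤-nonNeg ℚ.∣ q ∣ {{ℚ.∣-∣-nonNeg q}} p≤B ⟩
    B ℚ.* ℚ.∣ q ∣          ≤⟨ ℚ.*-monoˡ-≤-nonNeg B {{ℚ.nonNegative (ℚ.≤-trans (ℚ.0≤∣p∣ p) p≤B)}} q≤δ ⟩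
    B ℚ.* δ                ∎
    where open ℚ.≤-Reasoning

  *-close : ∀ a a′ e e′ {B C δ} → ℚ.∣ a ∣ ℚ.≤ B → ℚ.∣ e′ ∣ ℚ.≤ C →
            ℚ.∣ e ℚ.- e′ ∣ ℚ.≤ δ → ℚ.∣ a ℚ.- a′ ∣ ℚ.≤ δ →
            ℚ.∣ a ℚ.* e ℚ.- a′ ℚ.* e′ ∣ ℚ.≤ (B ℚ.+ C) ℚ.* δ
  *-close a a′ e e′ {B} {C} {δ} a≤B e′≤C h k = begin
    ℚ.∣ a ℚ.* e ℚ.- a′ ℚ.* e′ ∣                              ≡⟨ cong ℚ.∣_∣ (*-sub a a′ e e′) ⟩
    ℚ.∣ a ℚ.* (e ℚ.- e′) ℚ.+ e′ ℚ.* (a ℚ.- a′) ∣             ≤⟨ ℚ.∣p+q∣≤∣p∣+∣q∣ (a ℚ.* (e ℚ.- e′)) (e′ ℚ.* (a ℚ.- a′)) ⟩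
    ℚ.∣ a ℚ.* (e ℚ.- e′) ∣ ℚ.+ ℚ.∣ e′ ℚ.* (a ℚ.- a′) ∣       ≤⟨ ℚ.+-mono-≤ (*-bound a (e ℚ.- e′) a≤B h) (*-bound e′ (a ℚ.- a′) e′≤C k) ⟩
    B ℚ.* δ ℚ.+ C ℚ.* δ                                      ≡⟨ ℚ.*-distribʳ-+ δ B C ⟨
    (B ℚ.+ C) ℚ.* δ                                          ∎
    where open ℚ.≤-Reasoning

  divide : ∀ D ε → 0ℚ ℚ.< D → 0ℚ ℚ.< ε → ∃[ δ ] 0ℚ ℚ.< δ × D ℚ.* δ ≡ ε
  divide D ε D>0 ε>0 = 1/D ℚ.* ε , ℚ.positive⁻¹ _ {{ℚ.pos*pos⇒pos 1/D {{ℚ.1/pos⇒pos D}} ε {{ℚ.positive ε>0}}}} , eq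
    where
    instance
      D-pos : ℚ.Positive D
      D-pos = ℚ.positive D>0
      D-nonZero : ℚ.NonZero D
      D-nonZero = ℚ.pos⇒nonZero D
    1/D : ℚ
    1/D = ℚ.1/ D
    open ℚ.≤-Reasoning
    eq : D ℚ.* (1/D ℚ.* ε) ≡ ε
    eq = begin-equality
      D ℚ.* (1/D ℚ.* ε)   ≡⟨ ℚ.*-assoc D 1/D ε ⟨
      D ℚ.* 1/D ℚ.* ε     ≡⟨ cong (ℚ._* ε) (ℚ.*-inverseʳ D) ⟩
      1ℚ ℚ.* ε            ≡⟨ ℚ.*-identityˡ ε ⟩
      ε                   ∎

  ⊓-shift : ∀ {p q r s ε} → p ℚ.≤ r ℚ.+ ε → q ℚ.≤ s ℚ.+ ε → p ℚ.⊓ q ℚ.≤ (r ℚ.⊓ s) ℚ.+ ε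
  ⊓-shift {p} {q} {r} {s} {ε} h k = begin
    p ℚ.⊓ q                   ≤⟨ ℚ.⊓-mono-≤ h k ⟩
    (r ℚ.+ ε) ℚ.⊓ (s ℚ.+ ε)   ≡⟨ ℚ.mono-≤-distrib-⊓ (ℚ.+-monoˡ-≤ ε) r s ⟨
    (r ℚ.⊓ s) ℚ.+ ε           ∎
    where open ℚ.≤-Reasoning

  ⊓-close : ∀ a a′ e e′ {ε} →
            ℚ.∣ a ℚ.- a′ ∣ ℚ.≤ ε → ℚ.∣ e ℚ.- e′ ∣ ℚ.≤ ε →
            ℚ.∣ a′ ℚ.- a ∣ ℚ.≤ ε → ℚ.∣ e′ ℚ.- e ∣ ℚ.≤ ε →
            ℚ.∣ (a ℚ.⊓ e) ℚ.- (a′ ℚ.⊓ e′) ∣ ℚ.≤ ε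
  ⊓-close a a′ e e′ {ε} h k h′ k′ = ≤+⇒∣∣≤ {a ℚ.⊓ e} {a′ ℚ.⊓ e′}
    (⊓-shift {a} {e} {a′} {e′} (∣∣≤⇒≤+ {a} {a′} h) (∣∣≤⇒≤+ {e} {e′} k))
    (⊓-shift {a′} {e′} {a} {e} (∣∣≤⇒≤+ {a′} {a} h′) (∣∣≤⇒≤+ {e′} {e} k′))

abstract
  const-cauchy : ∀ q → IsCauchy (λ _ → q)
  const-cauchy q ε ε>0 = 0 , λ _ _ _ _ → ≤+⇒∣∣≤ {q} {q} q≤q+ε q≤q+ε
    where
    q≤q+ε : q ℚ.≤ q ℚ.+ ε
    q≤q+ε = ℚ.≤-trans (ℚ.≤-reflexive (sym (ℚ.+-identityʳ q))) (ℚ.+-monoʳ-≤ q (ℚ.<⇒≤ ε>0))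

  +-cauchy : ∀ x y → IsCauchy (λ n → seq x n ℚ.+ seq y n)
  +-cauchy x y ε ε>0 with cauchy x (½ ℚ.* ε) (0<½* ε>0) | cauchy y (½ ℚ.* ε) (0<½* ε>0)
  ... | N , c | M , d = N ℕ.⊔ M , λ m n m≥ n≥ → begin
    ℚ.∣ seq x m ℚ.+ seq y m ℚ.- (seq x n ℚ.+ seq y n) ∣
      ≡⟨ cong ℚ.∣_∣ (+-interchange (seq x m) (seq y m) (seq x n) (seq y n)) ⟩
    ℚ.∣ (seq x m ℚ.- seq x n) ℚ.+ (seq y m ℚ.- seq y n) ∣
      ≤⟨ ℚ.∣p+q∣≤∣p∣+∣q∣ (seq x m ℚ.- seq x n) (seq y m ℚ.- seq y n) ⟩
    ℚ.∣ seq x m ℚ.- seq x n ∣ ℚ.+ ℚ.∣ seq y m ℚ.- seq y n ∣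
      ≤⟨ ℚ.+-mono-≤ (c m n (⊔ˡ m≥) (⊔ˡ n≥)) (d m n (⊔ʳ {N} m≥) (⊔ʳ {N} n≥)) ⟩
    ½ ℚ.* ε ℚ.+ ½ ℚ.* ε
      ≡⟨ ½+½ ε ⟩
    ε ∎
    where open ℚ.≤-Reasoning

  neg-cauchy : ∀ x → IsCauchy (λ n → ℚ.- seq x n)
  neg-cauchy x ε ε>0 with cauchy x ε ε>0
  ... | N , c = N , λ m n m≥ n≥ →
    ℚ.≤-trans (ℚ.≤-reflexive (cong ℚ.∣_∣ (neg-sub (seq x m) (seq x n)))) (c n m n≥ m≥)

  *-cauchy : ∀ x y → IsCauchy (λ n → seq x n ℚ.* seq y n)
  *-cauchy x y ε ε>0 = from-bounds (eventually-bounded x) (eventually-bounded y)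
    where
    module _ {B C N₁ N₂ δ}
      (b : ∀ n → N₁ ℕ.≤ n → ℚ.∣ seq x n ∣ ℚ.≤ B)
      (c : ∀ n → N₂ ℕ.≤ n → ℚ.∣ seq y n ∣ ℚ.≤ C)
      (Dδ≡ε : (B ℚ.+ C) ℚ.* δ ≡ ε) where

      from-moduli : EventuallyWithin (seq x) δ → EventuallyWithin (seq y) δ → EventuallyWithin (λ n → seq x n ℚ.* seq y n) ε
      from-moduli (M₁ , cx) (M₂ , cy) = N ℕ.⊔ M , λ m n m≥ n≥ →
        ℚ.≤-trans
          (*-close (seq x m) (seq x n) (seq y m) (seq y n)
            (b m (⊔ˡ {N₁} (⊔ˡ {N} m≥))) (c n (⊔ʳ {N₁} (⊔ˡ {N} n≥)))
            (cy m n (⊔ʳ {M₁} (⊔ʳ {N} m≥)) (⊔ʳ {M₁} (⊔ʳ {N} n≥)))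
            (cx m n (⊔ˡ {M₁} (⊔ʳ {N} m≥)) (⊔ˡ {M₁} (⊔ʳ {N} n≥))))
          (ℚ.≤-reflexive Dδ≡ε)
        where
        N = N₁ ℕ.⊔ N₂
        M = M₁ ℕ.⊔ M₂

    from-bounds : Bounded (seq x) → Bounded (seq y) → EventuallyWithin (λ n → seq x n ℚ.* seq y n) ε
    from-bounds (B , B>0 , _ , b) (C , C>0 , _ , c) =
      let (δ , δ>0 , Dδ≡ε) = divide (B ℚ.+ C) ε (ℚ.+-mono-< B>0 C>0) ε>0
      in from-moduli b c Dδ≡ε (cauchy x δ δ>0) (cauchy y δ δ>0)

  ⊓-cauchy : ∀ x y → IsCauchy (λ n → seq x n ℚ.⊓ seq y n)
  ⊓-cauchy x y ε ε>0 with cauchy x ε ε>0 | cauchy y ε ε>0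
  ... | N , c | M , d = N ℕ.⊔ M , λ m n m≥ n≥ →
    ⊓-close (seq x m) (seq x n) (seq y m) (seq y n)
      (c m n (⊔ˡ m≥) (⊔ˡ n≥)) (d m n (⊔ʳ {N} m≥) (⊔ʳ {N} n≥))
      (c n m (⊔ˡ n≥) (⊔ˡ m≥)) (d n m (⊔ʳ {N} n≥) (⊔ʳ {N} m≥))

fromℚ : ℚ → ℝ
fromℚ q = mkℝ (λ _ → q) (const-cauchy q)

fromℕ : ℕ → ℝ
fromℕ n = fromℚ (+ n ℚ./ 1)

0ℝ 1ℝ 2ℝ : ℝ
0ℝ = fromℕ 0
1ℝ = fromℕ 1
2ℝ = fromℕ 2

_+_ : ℝ → ℝ → ℝ
x + y = mkℝ (λ n → seq x n ℚ.+ seq y n) (+-cauchy x y)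

-_ : ℝ → ℝ
- x = mkℝ (λ n → ℚ.- seq x n) (neg-cauchy x)

_-_ : ℝ → ℝ → ℝ
x - y = x + (- y)

_*_ : ℝ → ℝ → ℝ
x * y = mkℝ (λ n → seq x n ℚ.* seq y n) (*-cauchy x y)

_⊓_ : ℝ → ℝ → ℝ
x ⊓ y = mkℝ (λ n → seq x n ℚ.⊓ seq y n) (⊓-cauchy x y)

sumℝ : List ℝ → ℝ
sumℝ = foldr _+_ 0ℝ

_⟶_ : (ℕ → ℝ) → ℝ → Set
x ⟶ l = ∀ ε → 0ℚ ℚ.< ε →
  ∃[ N ] (∀ n → N ℕ.≤ n → x n ≤ l + fromℚ ε × l ≤ x n + fromℚ ε)

------------------------------------------------------------------------
-- Extended reals ℝ ∪ {∞}; ⊤⁺ is ∞ and fin embeds ℝ.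

open import Relation.Binary.Construct.Add.Supremum.NonStrict _≤_ public using (_≤⁺_)
open import Relation.Binary.Construct.Add.Supremum.Equality _≃_ public
  renaming (_≈⁺_ to _≃⁺_) using ()

ℝ∞ : Set
ℝ∞ = ℝ ⁺

infixl 6 _+∞_
infixl 7 _⊓∞_

_+∞_ : ℝ∞ → ℝ∞ → ℝ∞
fin x +∞ fin y = fin (x + y)
fin x +∞ ⊤⁺    = ⊤⁺
⊤⁺    +∞ _     = ⊤⁺

_⊓∞_ : ℝ∞ → ℝ∞ → ℝ∞
fin x ⊓∞ fin y = fin (x ⊓ y)
fin x ⊓∞ ⊤⁺    = fin x
⊤⁺    ⊓∞ y     = y

truncate : ℕ → ℝ∞ → ℝ
truncate N (fin x) = x ⊓ fromℕ N
truncate N ⊤⁺      = fromℕ N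

------------------------------------------------------------------------
-- Metric spaces and offline facility location

record MetricSpace : Set₁ where
  field
    Carrier  : Set
    _≈_      : Rel Carrier 0ℓ
    d        : Carrier → Carrier → ℝ
    isMetric : IsGeneralMetric _≈_ _≃_ _≤_ 0ℝ _+_ d

  -- Distance from a point to a finite set of facilities.
  dist : List Carrier → Carrier → ℝ∞
  dist F v = foldr (λ u r → fin (d u v) ⊓∞ r) ⊤⁺ F

-- The demands form a family indexed by Fin n, so repeated points are
-- distinct demands.
record Instance (n : ℕ) : Set₁ where
  field
    space   : MetricSpace
    demands : Vector (MetricSpace.Carrier space) n

  open MetricSpace space public

-- A finite set of facilities is given as a list, |F| being its length.
-- Repetitions in the list are paid for again and never help, so the
-- minimum over lists is the minimum over sets; infinite sets have
-- infinite cost.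
offlineCost : ∀ {n} (I : Instance n) → List (Instance.Carrier I) → ℝ∞
offlineCost {n} I F =
  fin (fromℕ (length F)) +∞ foldr (λ i r → dist F (demands i) +∞ r) (fin 0ℝ) (allFin n)
  where open Instance I

IsOPT : ∀ {n} → Instance n → ℝ → Set
IsOPT I o = (∃[ F ] offlineCost I F ≃⁺ fin o) × (∀ F → fin o ≤⁺ offlineCost I F)

------------------------------------------------------------------------
-- Probability spaces, presented (à la Daniell) by the integrable real
-- random variables and their expectation.  For a measure-theoretic
-- probability space take the L¹ functions and the Lebesgue integral.

record ProbabilitySpace : Set₁ where
  field
    Ω          : Set
    Integrable : (Ω → ℝ) → Set
    E          : (X : Ω → ℝ) → Integrable X → ℝ

    int-resp  : ∀ {X Y} → (∀ ω → X ω ≃ Y ω) → Integrable X → Integrable Y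
    int-const : ∀ c → Integrable (λ _ → c)
    int-+     : ∀ {X Y} → Integrable X → Integrable Y → Integrable (λ ω → X ω + Y ω)
    int-*     : ∀ c {X} → Integrable X → Integrable (λ ω → c * X ω)
    int-⊓     : ∀ {X Y} → Integrable X → Integrable Y → Integrable (λ ω → X ω ⊓ Y ω)

    E-1    : (i : Integrable (λ _ → 1ℝ)) → E (λ _ → 1ℝ) i ≃ 1ℝ
    E-+    : ∀ {X Y} (i : Integrable X) (j : Integrable Y)
             (k : Integrable (λ ω → X ω + Y ω)) → E _ k ≃ E X i + E Y j
    E-*    : ∀ c {X} (i : Integrable X) (k : Integrable (λ ω → c * X ω)) → E _ k ≃ c * E X i
    E-mono : ∀ {X Y} (i : Integrable X) (j : Integrable Y) →
             (∀ ω → X ω ≤ Y ω) → E X i ≤ E Y j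
    E-cont : (X : ℕ → Ω → ℝ) (i : ∀ k → Integrable (X k)) →
             (∀ k ω → X (suc k) ω ≤ X k ω) → (∀ ω → (λ k → X k ω) ⟶ 0ℝ) →
             (λ k → E (X k) (i k)) ⟶ 0ℝ

------------------------------------------------------------------------
-- Online algorithms

module _ (X : MetricSpace) where
  open MetricSpace X

  -- For a nonempty list v₁, …, v_ℓ of arrivals so far, the facilities
  -- opened in round ℓ.
  Rule : Set
  Rule = List Carrier → List Carrier

  -- Cost still to be accounted for, given the past arrivals, the open
  -- facilities F, and the arrivals to come.
  costFrom : Rule → (past F future : List Carrier) → ℝ∞
  costFrom rule past F []       = fin (fromℕ (length F))
  costFrom rule past F (v ∷ vs) = dist F′ v +∞ costFrom rule past′ F′ vs
    where
    past′ = past ∷ʳ v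
    F′    = F ++ rule past′

  onlineCost : Rule → List Carrier → ℝ∞
  onlineCost rule = costFrom rule [] []

-- All internal randomness is drawn up front as a seed ω; given ω and the
-- metric space the algorithm is deterministic.
record Algorithm : Set₁ where
  field
    seed : MetricSpace → ProbabilitySpace
    rule : (X : MetricSpace) → ProbabilitySpace.Ω (seed X) → Rule X
    -- The cost is a random variable, i.e. measurable.
    measurable : ∀ X vs N →
      ProbabilitySpace.Integrable (seed X) (λ ω → truncate N (onlineCost X (rule X ω) vs))

insertions : {A : Set} → A → List A → List (List A)
insertions x []       = [ [ x ] ]
insertions x (y ∷ ys) = (x ∷ y ∷ ys) ∷ map (y ∷_) (insertions x ys)

permutations : {A : Set} → List A → List (List A)
permutations []       = [ [] ]
permutations (x ∷ xs) = concatMap (insertions x) (permutations xs)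

-- E[min(ALG(I), N)] over a uniformly random arrival order and the seed.
truncatedExpectedCost : Algorithm → ∀ {n} → Instance n → ℕ → ℝ
truncatedExpectedCost A {n} I N =
  fromℚ (+ 1 ℚ./ n !) * sumℝ (map costOf (permutations (allFin n)))
  where
  open Instance I
  open Algorithm A
  open ProbabilitySpace (seed space)
  instance _ = n ℕ.!≢0

  costOf : List (Fin n) → ℝ
  costOf σ = E _ (measurable space (map demands σ) N)

-- c ≤ E[ALG(I)].  The cost takes values in [0,∞], so its expectation is
-- sup_N E[min(ALG(I), N)], possibly ∞.
ExpectedCostAtLeast : Algorithm → ∀ {n} → Instance n → ℝ → Set
ExpectedCostAtLeast A I c = ∀ ε → 0ℚ ℚ.< ε →
  ∃[ N ] c ≤ truncatedExpectedCost A I N + fromℚ ε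

{-# OPTIONS --safe #-}

-- Take leaves (i , a) with i < n and a < K = n² + 1, and one center for each
-- x ∈ Kⁿ, at distance ½ from the leaves (i , xᵢ); all other distances between
-- distinct points are 1. In the instance x, demand i is the leaf (i , xᵢ), so
-- opening the center x gives OPT = 1 + n/2 once n ≥ 2.
--
-- Let x be uniform. Before demand i arrives, xᵢ is independent of the open
-- facilities, and each of these is at distance < 1 from at most one leaf
-- (i , a). As long as fewer than n facilities are open, the arriving demand is
-- therefore, up to an expected n/K, at distance 1 from them, and so costs 1
-- whether or not facilities are opened for it. If n facilities are open, the
-- cost is n already. Hence the expected cost is at least n - n²/K ≥ n - 1 for
-- every arrival order, and some x does about as badly as the average.

module Submission where

open import Defs
open import Data.Nat.Base as ℕ using (ℕ)
open import Data.Product.Base using (Σ-syntax; ∃-syntax; _×_)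

open import Data.Bool.Base using (Bool; true; false; if_then_else_; T)
open import Data.Fin.Base using (Fin; zero; suc)
import Data.Fin.Properties as Fin
open import Data.Integer.Base as ℤ using (+_; +[1+_]; -[1+_])
import Data.Integer.Properties as ℤ
open import Data.List.Base using (List; []; _∷_; _++_; _∷ʳ_; map; length; foldr; concatMap; cartesianProductWith; allFin)
import Data.List.Properties as List
open import Data.List.Relation.Binary.Permutation.Propositional using (_↭_; ↭-refl; ↭-sym; ↭-trans; ↭-prep; ↭-swap; ↭⇒↭ₛ)
import Data.List.Relation.Binary.Permutation.Propositional.Properties as ↭
import Data.List.Relation.Binary.Permutation.Setoid.Properties as ↭ₛ
open import Data.List.Relation.Unary.All as All using (All; []; _∷_)
import Data.List.Relation.Unary.All.Properties as All
open import Data.List.Relation.Unary.AllPairs using ([]; _∷_)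
open import Data.List.Relation.Unary.Unique.Propositional using (Unique)
open import Data.List.Relation.Unary.Unique.Propositional.Properties using (allFin⁺)
open import Data.Nat.Base using (zero; suc; _!)
open import Data.Nat.ListAction using (sum)
open import Data.Nat.ListAction.Properties using (sum-++)
import Data.Nat.Properties as ℕ
open import Data.Nat.Tactic.RingSolver using (solve-∀)
open import Data.Product.Base using (_,_; proj₁; proj₂)
open import Data.Rational.Base as ℚ using (ℚ; mkℚ; 0ℚ; 1ℚ; ½)
import Data.Rational.Properties as ℚ
open import Data.Rational.Solver using (module +-*-Solver)
open import Data.Rational.Unnormalised.Base as ℚᵘ using (mkℚᵘ)
import Data.Rational.Unnormalised.Properties as ℚᵘ
open import Data.Sum.Base using (_⊎_; inj₁; inj₂)
open import Data.Unit.Base using (⊤; tt)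
open import Data.Vec.Base using (Vec; []; _∷_; lookup; _[_]≔_)
import Data.Vec.Properties as Vec
open import Function.Base using (_∘_)
open import Level using (0ℓ)
open import Relation.Binary.Bundles using (Poset)
open import Relation.Binary.Construct.Add.Supremum.Equality _≃_ using () renaming ([_] to fin≃)
open import Relation.Binary.Construct.Add.Supremum.NonStrict _≤_ using (_≤⊤⁺) renaming ([_] to fin≤)
open import Relation.Binary.Definitions using (DecidableEquality)
open import Relation.Binary.PropositionalEquality
import Relation.Binary.Reasoning.PartialOrder as PosetReasoning
open import Relation.Binary.Structures using (IsPartialOrder)
open import Relation.Nullary.Construct.Add.Supremum using (⊤⁺) renaming ([_] to fin)
open import Relation.Nullary.Decidable using (Dec; does; yes; no; map′; _×-dec_; decidable-stable)
open import Relation.Nullary.Negation.Core using (contradiction)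

-- Finite sums over lists

private
  variable
    A B C : Set
    n : ℕ

∑ : List A → (A → ℕ) → ℕ
∑ xs f = sum (map f xs)

∑-mono-All : ∀ {xs : List A} {f g : A → ℕ} → All (λ x → f x ℕ.≤ g x) xs → ∑ xs f ℕ.≤ ∑ xs g
∑-mono-All []           = ℕ.z≤n
∑-mono-All (f≤g ∷ f≤gs) = ℕ.+-mono-≤ f≤g (∑-mono-All f≤gs)

∑-mono : ∀ (xs : List A) {f g : A → ℕ} → (∀ x → f x ℕ.≤ g x) → ∑ xs f ℕ.≤ ∑ xs g
∑-mono xs f≤g = ∑-mono-All (All.universal f≤g xs)

∑-cong : ∀ (xs : List A) {f g : A → ℕ} → (∀ x → f x ≡ g x) → ∑ xs f ≡ ∑ xs g
∑-cong xs f≗g = cong sum (List.map-cong f≗g xs)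

∑-const : ∀ (xs : List A) c → ∑ xs (λ _ → c) ≡ length xs ℕ.* c
∑-const []       c = refl
∑-const (x ∷ xs) c = cong (c ℕ.+_) (∑-const xs c)

+-interchange : ∀ a b c d → (a ℕ.+ b) ℕ.+ (c ℕ.+ d) ≡ (a ℕ.+ c) ℕ.+ (b ℕ.+ d)
+-interchange = solve-∀

∑-+ : ∀ (xs : List A) (f g : A → ℕ) → ∑ xs (λ x → f x ℕ.+ g x) ≡ ∑ xs f ℕ.+ ∑ xs g
∑-+ []       f g = refl
∑-+ (x ∷ xs) f g = trans (cong (f x ℕ.+ g x ℕ.+_) (∑-+ xs f g)) (+-interchange (f x) (g x) (∑ xs f) (∑ xs g))

∑-* : ∀ c (xs : List A) (f : A → ℕ) → ∑ xs (λ x → c ℕ.* f x) ≡ c ℕ.* ∑ xs f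
∑-* c []       f = sym (ℕ.*-zeroʳ c)
∑-* c (x ∷ xs) f = trans (cong (c ℕ.* f x ℕ.+_) (∑-* c xs f)) (sym (ℕ.*-distribˡ-+ c (f x) (∑ xs f)))

∑-swap : ∀ (xs : List A) (ys : List B) (f : A → B → ℕ) →
         ∑ xs (λ x → ∑ ys (f x)) ≡ ∑ ys (λ y → ∑ xs (λ x → f x y))
∑-swap []       ys f = sym (trans (∑-const ys 0) (ℕ.*-zeroʳ (length ys)))
∑-swap (x ∷ xs) ys f = trans (cong (∑ ys (f x) ℕ.+_) (∑-swap xs ys f)) (sym (∑-+ ys (f x) (λ y → ∑ xs (λ x → f x y))))

∑-cartesianProductWith : ∀ (g : A → B → C) xs ys (f : C → ℕ) →
  ∑ (cartesianProductWith g xs ys) f ≡ ∑ xs (λ x → ∑ ys (λ y → f (g x y)))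
∑-cartesianProductWith g []       ys f = refl
∑-cartesianProductWith g (x ∷ xs) ys f = begin
  sum (map f (map (g x) ys ++ zs))         ≡⟨ cong sum (List.map-++ f (map (g x) ys) zs) ⟩
  sum (map f (map (g x) ys) ++ map f zs)   ≡⟨ sum-++ (map f (map (g x) ys)) (map f zs) ⟩
  sum (map f (map (g x) ys)) ℕ.+ ∑ zs f    ≡⟨ cong₂ ℕ._+_ (cong sum (sym (List.map-∘ ys))) (∑-cartesianProductWith g xs ys f) ⟩
  ∑ ys (λ y → f (g x y)) ℕ.+ ∑ xs (λ x → ∑ ys (λ y → f (g x y)))  ∎
  where
  open ≡-Reasoning
  zs = cartesianProductWith g xs ys

module _ (_≟_ : DecidableEquality A) where

  ∑-indicator-∉ : ∀ {t xs} c → All (t ≢_) xs → ∑ xs (λ x → if does (t ≟ x) then c else 0) ≡ 0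
  ∑-indicator-∉ c [] = refl
  ∑-indicator-∉ {t} {x ∷ _} c (t≢x ∷ t∉xs) with t ≟ x
  ... | yes t≡x = contradiction t≡x t≢x
  ... | no  _   = ∑-indicator-∉ c t∉xs

  ∑-indicator : ∀ {xs} t c → Unique xs → ∑ xs (λ x → if does (t ≟ x) then c else 0) ℕ.≤ c
  ∑-indicator t c [] = ℕ.z≤n
  ∑-indicator {x ∷ _} t c (x∉xs ∷ xs!) with t ≟ x
  ... | yes refl = ℕ.≤-reflexive (trans (cong (c ℕ.+_) (∑-indicator-∉ c x∉xs)) (ℕ.+-identityʳ c))
  ... | no  _    = ∑-indicator t c xs!

-- Words and resampling of a coordinate

words : List A → (n : ℕ) → List (Vec A n)
words as zero    = [] ∷ []
words as (suc n) = cartesianProductWith _∷_ as (words as n)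

length-words : ∀ (as : List A) n → length (words as n) ≡ length as ℕ.^ n
length-words as zero    = refl
length-words as (suc n) = begin
  length (words as (suc n))                ≡⟨ length≡∑1 (words as (suc n)) ⟩
  ∑ (words as (suc n)) (λ _ → 1)           ≡⟨ ∑-cartesianProductWith _∷_ as (words as n) _ ⟩
  ∑ as (λ _ → ∑ (words as n) (λ _ → 1))    ≡⟨ ∑-const as _ ⟩
  length as ℕ.* ∑ (words as n) (λ _ → 1)   ≡⟨ cong (length as ℕ.*_) (length≡∑1 (words as n)) ⟨
  length as ℕ.* length (words as n)        ≡⟨ cong (length as ℕ.*_) (length-words as n) ⟩
  length as ℕ.* length as ℕ.^ n            ∎
  where
  open ≡-Reasoning
  length≡∑1 : ∀ {B : Set} (xs : List B) → length xs ≡ ∑ xs (λ _ → 1)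
  length≡∑1 xs = sym (trans (∑-const xs 1) (ℕ.*-identityʳ (length xs)))

-- Redrawing one coordinate of a uniform word leaves it uniform. In counting form, the old value of
-- that coordinate is discarded, which contributes the factor `length as`.
∑-resample : ∀ (as : List A) (i : Fin n) (f : Vec A n → ℕ) →
  ∑ (words as n) (λ x → ∑ as (λ a → f (x [ i ]≔ a))) ≡ length as ℕ.* ∑ (words as n) f
∑-resample {n = suc n} as zero f = begin
  ∑ (words as (suc n)) (λ x → ∑ as (λ a → f (x [ zero ]≔ a)))         ≡⟨ ∑-cartesianProductWith _∷_ as ws _ ⟩
  ∑ as (λ _ → ∑ ws (λ x → ∑ as (λ a → f (a ∷ x))))                    ≡⟨ ∑-const as _ ⟩
  length as ℕ.* ∑ ws (λ x → ∑ as (λ a → f (a ∷ x)))                   ≡⟨ cong (length as ℕ.*_) (∑-swap ws as _) ⟩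
  length as ℕ.* ∑ as (λ a → ∑ ws (λ x → f (a ∷ x)))                   ≡⟨ cong (length as ℕ.*_) (∑-cartesianProductWith _∷_ as ws f) ⟨
  length as ℕ.* ∑ (words as (suc n)) f                                ∎
  where
  open ≡-Reasoning
  ws = words as n
∑-resample {n = suc n} as (suc i) f = begin
  ∑ (words as (suc n)) (λ x → ∑ as (λ a → f (x [ suc i ]≔ a)))        ≡⟨ ∑-cartesianProductWith _∷_ as ws _ ⟩
  ∑ as (λ b → ∑ ws (λ x → ∑ as (λ a → f (b ∷ (x [ i ]≔ a)))))         ≡⟨ ∑-cong as (λ b → ∑-resample as i (λ x → f (b ∷ x))) ⟩
  ∑ as (λ b → length as ℕ.* ∑ ws (λ x → f (b ∷ x)))                   ≡⟨ ∑-* (length as) as _ ⟩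
  length as ℕ.* ∑ as (λ b → ∑ ws (λ x → f (b ∷ x)))                   ≡⟨ cong (length as ℕ.*_) (∑-cartesianProductWith _∷_ as ws f) ⟨
  length as ℕ.* ∑ (words as (suc n)) f                                ∎
  where
  open ≡-Reasoning
  ws = words as n

-- Costs with integer distances

module Capped {P : Set} (δ : P → P → ℕ) where

  -- The cap also makes the distance from no facilities finite; this only
  -- lowers the costs, which is harmless for lower bounds.
  cappedDist : ℕ → List P → P → ℕ
  cappedDist c F v = foldr (λ u r → δ u v ℕ.⊓ r) c F

  gain : ℕ → List P → P → ℕ
  gain c F v = ∑ F (λ u → c ℕ.∸ δ u v)

  -- A union bound: the minimum is either the cap or some `δ u v`, and in the latter case the single
  -- summand `c ∸ δ u v` of the gain makes up the difference to `c`.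
  cappedDist+gain : ∀ c F v → c ℕ.≤ cappedDist c F v ℕ.+ gain c F v
  cappedDist+gain c []      v = ℕ.m≤m+n c 0
  cappedDist+gain c (u ∷ F) v with ℕ.⊓-sel (δ u v) (cappedDist c F v)
  ... | inj₁ e rewrite e = ℕ.≤-trans (ℕ.m≤n+m∸n c (δ u v)) (ℕ.+-monoʳ-≤ (δ u v) (ℕ.m≤m+n _ _))
  ... | inj₂ e rewrite e = ℕ.≤-trans (cappedDist+gain c F v) (ℕ.+-monoʳ-≤ (cappedDist c F v) (ℕ.m≤n+m _ _))

  cappedDist-mono : ∀ {b c} F v → b ℕ.≤ c → cappedDist b F v ℕ.≤ cappedDist c F v
  cappedDist-mono []      v b≤c = b≤c
  cappedDist-mono (u ∷ F) v b≤c = ℕ.⊓-monoʳ-≤ (δ u v) (cappedDist-mono F v b≤c)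

  ∑-cappedDist : ∀ {A : Set} c F (is : List A) (v : A → P) →
    length is ℕ.* c ℕ.≤ ∑ is (λ i → cappedDist c F (v i)) ℕ.+ ∑ F (λ u → ∑ is (λ i → c ℕ.∸ δ u (v i)))
  ∑-cappedDist c F is v = begin
    length is ℕ.* c                                               ≡⟨ ∑-const is c ⟨
    ∑ is (λ _ → c)                                                ≤⟨ ∑-mono is (λ i → cappedDist+gain c F (v i)) ⟩
    ∑ is (λ i → cappedDist c F (v i) ℕ.+ gain c F (v i))          ≡⟨ ∑-+ is _ _ ⟩
    ∑ is (λ i → cappedDist c F (v i)) ℕ.+ ∑ is (λ i → gain c F (v i))
      ≡⟨ cong (∑ is (λ i → cappedDist c F (v i)) ℕ.+_) (∑-swap is F _) ⟩
    ∑ is (λ i → cappedDist c F (v i)) ℕ.+ ∑ F (λ u → ∑ is (λ i → c ℕ.∸ δ u (v i)))  ∎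
    where open ℕ.≤-Reasoning

  -- Online costs and the savings of a rule

  module Online (rule : List P → List P) where

    cost : (past F future : List P) → ℕ
    cost past F []       = 2 ℕ.* length F
    cost past F (v ∷ vs) = cappedDist 2 F′ v ℕ.+ cost past′ F′ vs
      where
      past′ = past ∷ʳ v
      F′    = F ++ rule past′

    -- Facilities are never closed, and the final number of them is charged, at 2 each in the
    -- doubled scale.
    2*open≤cost : ∀ past F vs → 2 ℕ.* length F ℕ.≤ cost past F vs
    2*open≤cost past F []       = ℕ.≤-refl
    2*open≤cost past F (v ∷ vs) = begin
      2 ℕ.* length F     ≤⟨ ℕ.*-monoʳ-≤ 2 (ℕ.≤-trans (ℕ.m≤m+n (length F) _) (ℕ.≤-reflexive (sym (List.length-++ F)))) ⟩
      2 ℕ.* length F′    ≤⟨ 2*open≤cost past′ F′ vs ⟩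
      cost past′ F′ vs   ≤⟨ ℕ.m≤n+m _ _ ⟩
      cappedDist 2 F′ v ℕ.+ cost past′ F′ vs ∎
      where
      open ℕ.≤-Reasoning
      past′ = past ∷ʳ v
      F′    = F ++ rule past′

    module _ (m : ℕ) where

      -- Meant for the facilities open before `v` arrives, which cannot depend on the coordinate
      -- that `v` reveals. Setting it to 0 from `m` facilities on keeps its average bounded,
      -- whatever the rule opens.
      loss : List P → P → ℕ
      loss F v = if length F ℕ.<ᵇ m then gain 2 F v else 0

      losses : (past F future : List P) → ℕ
      losses past F []       = 0
      losses past F (v ∷ vs) = loss F v ℕ.+ losses past′ (F ++ rule past′) vs
        where past′ = past ∷ʳ v

      -- The potential is `2 * (m ⊓ (open + remaining))`. If nothing is opened, it drops by at most
      -- 2, which the arriving demand pays up to the gain. Otherwise a new facility replaces the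
      -- arrival in the count, and the potential does not drop.
      round-bound : ∀ F G v l → 2 ℕ.* (m ℕ.⊓ (length F ℕ.+ suc l)) ℕ.≤
              (cappedDist 2 (F ++ G) v ℕ.+ gain 2 F v) ℕ.+ 2 ℕ.* (m ℕ.⊓ (length (F ++ G) ℕ.+ l))
      round-bound F [] v l rewrite List.++-identityʳ F = begin
        2 ℕ.* (m ℕ.⊓ (length F ℕ.+ suc l))       ≤⟨ ℕ.*-monoʳ-≤ 2 (ℕ.⊓-mono-≤ (ℕ.n≤1+n m) (ℕ.≤-reflexive (ℕ.+-suc (length F) l))) ⟩
        2 ℕ.* suc (m ℕ.⊓ (length F ℕ.+ l))       ≡⟨ ℕ.*-suc 2 _ ⟩
        2 ℕ.+ 2 ℕ.* (m ℕ.⊓ (length F ℕ.+ l))     ≤⟨ ℕ.+-monoˡ-≤ _ (cappedDist+gain 2 F v) ⟩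
        (cappedDist 2 F v ℕ.+ gain 2 F v) ℕ.+ 2 ℕ.* (m ℕ.⊓ (length F ℕ.+ l)) ∎
        where open ℕ.≤-Reasoning
      round-bound F G@(_ ∷ gs) v l = begin
        2 ℕ.* (m ℕ.⊓ (length F ℕ.+ suc l))           ≤⟨ ℕ.*-monoʳ-≤ 2 (ℕ.⊓-monoʳ-≤ m longer) ⟩
        2 ℕ.* (m ℕ.⊓ (length (F ++ G) ℕ.+ l))        ≤⟨ ℕ.m≤n+m _ (cappedDist 2 (F ++ G) v ℕ.+ gain 2 F v) ⟩
        (cappedDist 2 (F ++ G) v ℕ.+ gain 2 F v) ℕ.+ 2 ℕ.* (m ℕ.⊓ (length (F ++ G) ℕ.+ l)) ∎
        where
        open ℕ.≤-Reasoning
        longer : length F ℕ.+ suc l ℕ.≤ length (F ++ G) ℕ.+ l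
        longer = begin
          length F ℕ.+ suc l                   ≤⟨ ℕ.+-monoʳ-≤ (length F) (ℕ.s≤s (ℕ.m≤n+m l (length gs))) ⟩
          length F ℕ.+ (length G ℕ.+ l)        ≡⟨ ℕ.+-assoc (length F) _ l ⟨
          length F ℕ.+ length G ℕ.+ l          ≡⟨ cong (ℕ._+ l) (List.length-++ F) ⟨
          length (F ++ G) ℕ.+ l                ∎

      -- While fewer than `m` facilities are open, `round-bound` accounts for the round. Once `m`
      -- are open, the potential is at most `2 * m`, and the open facilities alone cost that much.
      cost+losses : ∀ past F vs → 2 ℕ.* (m ℕ.⊓ (length F ℕ.+ length vs)) ℕ.≤ cost past F vs ℕ.+ losses past F vs
      cost+losses past F [] = ℕ.≤-trans (ℕ.*-monoʳ-≤ 2 (ℕ.m⊓n≤n m _)) (ℕ.≤-reflexive (lemma (length F)))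
        where
        lemma : ∀ l → 2 ℕ.* (l ℕ.+ 0) ≡ 2 ℕ.* l ℕ.+ 0
        lemma = solve-∀
      cost+losses past F (v ∷ vs) with length F ℕ.<ᵇ m in eq
      ... | false = begin
        2 ℕ.* (m ℕ.⊓ (length F ℕ.+ suc (length vs)))   ≤⟨ ℕ.*-monoʳ-≤ 2 (ℕ.≤-trans (ℕ.m⊓n≤m m _) (ℕ.≮⇒≥ F≮m)) ⟩
        2 ℕ.* length F                                 ≤⟨ 2*open≤cost past F (v ∷ vs) ⟩
        cost past F (v ∷ vs)                           ≤⟨ ℕ.m≤m+n _ _ ⟩
        cost past F (v ∷ vs) ℕ.+ losses (past ∷ʳ v) (F ++ rule (past ∷ʳ v)) vs ∎
        where
        open ℕ.≤-Reasoning
        F≮m : length F ℕ.≮ m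
        F≮m F<m = subst T eq (ℕ.<⇒<ᵇ F<m)
      ... | true = begin
        2 ℕ.* (m ℕ.⊓ (length F ℕ.+ suc (length vs)))   ≤⟨ round-bound F (rule past′) v (length vs) ⟩
        (d ℕ.+ gain 2 F v) ℕ.+ 2 ℕ.* (m ℕ.⊓ (length F′ ℕ.+ length vs))
                                                       ≤⟨ ℕ.+-monoʳ-≤ (d ℕ.+ gain 2 F v) (cost+losses past′ F′ vs) ⟩
        (d ℕ.+ gain 2 F v) ℕ.+ (cost past′ F′ vs ℕ.+ losses past′ F′ vs)
                                                       ≡⟨ +-interchange d (gain 2 F v) _ _ ⟩
        (d ℕ.+ cost past′ F′ vs) ℕ.+ (gain 2 F v ℕ.+ losses past′ F′ vs) ∎
        where
        open ℕ.≤-Reasoning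
        past′ = past ∷ʳ v
        F′    = F ++ rule past′
        d     = cappedDist 2 F′ v

      module _ {n K : ℕ} (leaf : Fin n → Fin K → P)
               (one-hit : ∀ u i → ∑ (allFin K) (λ a → 2 ℕ.∸ δ u (leaf i a)) ℕ.≤ 2) where

        private
          demand : Vec (Fin K) n → Fin n → P
          demand x i = leaf i (lookup x i)

          W : List (Vec (Fin K) n)
          W = words (allFin K) n

        -- By `one-hit`, each open facility contributes at most 2 over all values `a`, and `loss`
        -- vanishes unless fewer than `m` are open.
        ∑-loss : ∀ F i → ∑ (allFin K) (λ a → loss F (leaf i a)) ℕ.≤ m ℕ.* 2
        ∑-loss F i with length F ℕ.<ᵇ m in eq
        ... | false = ℕ.≤-trans (ℕ.≤-reflexive (trans (∑-const (allFin K) 0) (ℕ.*-zeroʳ (length (allFin K))))) ℕ.z≤n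
        ... | true  = begin
          ∑ (allFin K) (λ a → gain 2 F (leaf i a))                  ≡⟨ ∑-swap (allFin K) F _ ⟩
          ∑ F (λ u → ∑ (allFin K) (λ a → 2 ℕ.∸ δ u (leaf i a)))     ≤⟨ ∑-mono F (λ u → one-hit u i) ⟩
          ∑ F (λ _ → 2)                                             ≡⟨ ∑-const F 2 ⟩
          length F ℕ.* 2                                            ≤⟨ ℕ.*-monoˡ-≤ 2 (ℕ.<⇒≤ F<m) ⟩
          m ℕ.* 2                                                   ∎
          where
          open ℕ.≤-Reasoning
          F<m : length F ℕ.< m
          F<m = ℕ.<ᵇ⇒< (length F) m (subst T (sym eq) _)

        -- The hypothesis on past and F says that they depend only on coordinates
        -- of x already revealed, i.e. outside σ.
        ∑-losses : ∀ {σ} → Unique σ → (past F : Vec (Fin K) n → List P) →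
          All (λ i → ∀ x a → past (x [ i ]≔ a) ≡ past x × F (x [ i ]≔ a) ≡ F x) σ →
          length (allFin K) ℕ.* ∑ W (λ x → losses (past x) (F x) (map (demand x) σ)) ℕ.≤ length σ ℕ.* (length W ℕ.* (m ℕ.* 2))
        ∑-losses {[]} _ past F _ = ℕ.≤-reflexive (begin
          length (allFin K) ℕ.* ∑ W (λ _ → 0)         ≡⟨ cong (length (allFin K) ℕ.*_) (trans (∑-const W 0) (ℕ.*-zeroʳ (length W))) ⟩
          length (allFin K) ℕ.* 0                     ≡⟨ ℕ.*-zeroʳ (length (allFin K)) ⟩
          0                                           ∎)
          where open ≡-Reasoning
        ∑-losses {i ∷ σ} (i∉σ ∷ σ!) past F (fixed-i ∷ fixed-σ) = begin
          k ℕ.* ∑ W (λ x → loss (F x) (demand x i) ℕ.+ rest x)                ≡⟨ cong (k ℕ.*_) (∑-+ W _ rest) ⟩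
          k ℕ.* (∑ W (λ x → loss (F x) (demand x i)) ℕ.+ ∑ W rest)            ≡⟨ ℕ.*-distribˡ-+ k _ (∑ W rest) ⟩
          k ℕ.* ∑ W (λ x → loss (F x) (demand x i)) ℕ.+ k ℕ.* ∑ W rest        ≤⟨ ℕ.+-mono-≤ now later ⟩
          length W ℕ.* (m ℕ.* 2) ℕ.+ length σ ℕ.* (length W ℕ.* (m ℕ.* 2))    ∎
          where
          open ℕ.≤-Reasoning
          k = length (allFin K)
          past′ F′ : Vec (Fin K) n → List P
          past′ x = past x ∷ʳ demand x i
          F′ x = F x ++ rule (past′ x)
          rest : Vec (Fin K) n → ℕ
          rest x = losses (past′ x) (F′ x) (map (demand x) σ)

          -- Redrawing coordinate `i` leaves `F x` unchanged, so the arriving leaf is uniform given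
          -- the open facilities, and `∑-loss` applies for each fixed `x`.
          now : k ℕ.* ∑ W (λ x → loss (F x) (demand x i)) ℕ.≤ length W ℕ.* (m ℕ.* 2)
          now = begin
            k ℕ.* ∑ W (λ x → loss (F x) (demand x i))                                             ≡⟨ ∑-resample (allFin K) i _ ⟨
            ∑ W (λ x → ∑ (allFin K) (λ a → loss (F (x [ i ]≔ a)) (demand (x [ i ]≔ a) i)))
              ≡⟨ ∑-cong W (λ x → ∑-cong (allFin K) (λ a → cong₂ loss (proj₂ (fixed-i x a)) (cong (leaf i) (Vec.lookup∘update i x a)))) ⟩
            ∑ W (λ x → ∑ (allFin K) (λ a → loss (F x) (leaf i a)))                                ≤⟨ ∑-mono W (λ x → ∑-loss (F x) i) ⟩
            ∑ W (λ _ → m ℕ.* 2)                                                                   ≡⟨ ∑-const W _ ⟩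
            length W ℕ.* (m ℕ.* 2)                                                                ∎

          -- The new history reveals coordinate `i`, but `σ` has no repetitions, so changing a later
          -- coordinate `j` still leaves the history fixed.
          fixed′ : ∀ {j} → i ≢ j → (∀ x a → past (x [ j ]≔ a) ≡ past x × F (x [ j ]≔ a) ≡ F x) →
                   ∀ x a → past′ (x [ j ]≔ a) ≡ past′ x × F′ (x [ j ]≔ a) ≡ F′ x
          fixed′ i≢j fixed-j x a = past′-fixed , cong₂ _++_ F-fixed (cong rule past′-fixed)
            where
            past-fixed = proj₁ (fixed-j x a)
            F-fixed = proj₂ (fixed-j x a)
            past′-fixed = cong₂ _∷ʳ_ past-fixed (cong (leaf i) (Vec.lookup∘update′ i≢j x a))

          later : k ℕ.* ∑ W rest ℕ.≤ length σ ℕ.* (length W ℕ.* (m ℕ.* 2))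
          later = ∑-losses σ! past′ F′ (All.zipWith (λ (i≢j , fixed-j) → fixed′ i≢j fixed-j) (i∉σ , fixed-σ))

-- Permutations and the hard metric space

insertions-↭ : ∀ (x : A) ys → All (_↭ x ∷ ys) (insertions x ys)
insertions-↭ x []       = ↭-refl ∷ []
insertions-↭ x (y ∷ ys) = ↭-refl ∷ All.map⁺ (All.map (λ p → ↭-trans (↭-prep y p) (↭-swap y x ↭-refl)) (insertions-↭ x ys))

permutations-↭ : ∀ (xs : List A) → All (_↭ xs) (permutations xs)
permutations-↭ []       = ↭-refl ∷ []
permutations-↭ (x ∷ xs) = All.concat⁺ (All.map⁺ (All.map extend (permutations-↭ xs)))
  where
  extend : ∀ {ys} → ys ↭ xs → All (_↭ x ∷ xs) (insertions x ys)
  extend {ys} ys↭xs = All.map (λ p → ↭-trans p (↭-prep x ys↭xs)) (insertions-↭ x ys)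

length-insertions : ∀ (x : A) ys → length (insertions x ys) ≡ suc (length ys)
length-insertions x []       = refl
length-insertions x (y ∷ ys) = cong suc (trans (List.length-map (y ∷_) (insertions x ys)) (length-insertions x ys))

length-concatMap : ∀ {f : A → List B} {xs c} → All (λ x → length (f x) ≡ c) xs → length (concatMap f xs) ≡ length xs ℕ.* c
length-concatMap [] = refl
length-concatMap {f = f} {x ∷ xs} (e ∷ es) = trans (List.length-++ (f x)) (cong₂ ℕ._+_ e (length-concatMap es))

-- Matches the normalization `1 / n !` in the expected cost with the number of listed orders.
length-permutations : ∀ (xs : List A) → length (permutations xs) ≡ length xs !
length-permutations []       = refl
length-permutations (x ∷ xs) = begin
  length (concatMap (insertions x) (permutations xs))   ≡⟨ length-concatMap (All.map (λ {ys} p → trans (length-insertions x ys) (cong suc (↭.↭-length p))) (permutations-↭ xs)) ⟩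
  length (permutations xs) ℕ.* suc (length xs)          ≡⟨ cong (ℕ._* suc (length xs)) (length-permutations xs) ⟩
  length xs ! ℕ.* suc (length xs)                       ≡⟨ ℕ.*-comm (length xs !) _ ⟩
  suc (length xs) !                                     ∎
  where open ≡-Reasoning

module HiddenCenters (n : ℕ) where

  K : ℕ
  K = suc (n ℕ.* n)

  data Point : Set where
    leaf   : Fin n → Fin K → Point
    center : Vec (Fin K) n → Point

  infix 4 _≟_
  _≟_ : DecidableEquality Point
  leaf i a ≟ leaf j b = map′ (λ { (refl , refl) → refl }) (λ { refl → refl , refl }) (i Fin.≟ j ×-dec a Fin.≟ b)
  leaf _ _ ≟ center _ = no λ ()
  center _ ≟ leaf _ _ = no λ ()
  center x ≟ center y = map′ (cong center) (λ { refl → refl }) (Vec.≡-dec Fin._≟_ x y)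

  incident : Point → Point → Bool
  incident (leaf i a) (center x) = does (lookup x i Fin.≟ a)
  incident (center x) (leaf i a) = does (lookup x i Fin.≟ a)
  incident (leaf _ _) (leaf _ _) = false
  incident (center _) (center _) = false

  incident-sym : ∀ p q → incident p q ≡ incident q p
  incident-sym (leaf _ _) (leaf _ _) = refl
  incident-sym (leaf _ _) (center _) = refl
  incident-sym (center _) (leaf _ _) = refl
  incident-sym (center _) (center _) = refl

  -- Twice the distance, so that all costs are natural numbers.
  δ : Point → Point → ℕ
  δ p q = if does (p ≟ q) then 0 else if incident p q then 1 else 2

  δ≤2 : ∀ p q → δ p q ℕ.≤ 2
  δ≤2 p q with does (p ≟ q) | incident p q
  ... | true  | _     = ℕ.z≤n
  ... | false | true  = ℕ.s≤s ℕ.z≤n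
  ... | false | false = ℕ.≤-refl

  1≤δ : ∀ {p q} → p ≢ q → 1 ℕ.≤ δ p q
  1≤δ {p} {q} p≢q with p ≟ q | incident p q
  ... | yes p≡q | _     = contradiction p≡q p≢q
  ... | no  _   | true  = ℕ.≤-refl
  ... | no  _   | false = ℕ.s≤s ℕ.z≤n

  δ-refl : ∀ p → δ p p ≡ 0
  δ-refl p with p ≟ p
  ... | yes _  = refl
  ... | no p≢p = contradiction refl p≢p

  δ-sym : ∀ p q → δ p q ≡ δ q p
  δ-sym p q with p ≟ q | q ≟ p
  ... | yes _   | yes _   = refl
  ... | yes p≡q | no  q≢p = contradiction (sym p≡q) q≢p
  ... | no  p≢q | yes q≡p = contradiction (sym q≡p) p≢q
  ... | no  _   | no  _   = cong (if_then 1 else 2) (incident-sym p q)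

  -- Distinct points have `δ` equal to 1 or 2, so two nontrivial steps already total at least 2, the
  -- largest value.
  δ-triangle : ∀ p q r → δ p r ℕ.≤ δ p q ℕ.+ δ q r
  δ-triangle p q r = by-cases (p ≟ q) (q ≟ r)
    where
    by-cases : Dec (p ≡ q) → Dec (q ≡ r) → δ p r ℕ.≤ δ p q ℕ.+ δ q r
    by-cases (yes refl) _          = ℕ.m≤n+m (δ p r) (δ p p)
    by-cases (no _)     (yes refl) = ℕ.m≤m+n (δ p r) (δ r r)
    by-cases (no p≢q)   (no q≢r)   = ℕ.≤-trans (δ≤2 p r) (ℕ.+-mono-≤ (1≤δ p≢q) (1≤δ q≢r))

  -- The only `a` for which the point can be nearer than 2 to `leaf i a`. For `leaf j b` with
  -- `j ≢ i` there is no such `a`, and `b` is a harmless default.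
  target : Point → Fin n → Fin K
  target (leaf _ b) _ = b
  target (center y) i = lookup y i

  one-hit : ∀ u i → ∑ (allFin K) (λ a → 2 ℕ.∸ δ u (leaf i a)) ℕ.≤ 2
  one-hit u i = ℕ.≤-trans (∑-mono (allFin K) (λ a → hit u i a)) (∑-indicator Fin._≟_ (target u i) 2 (allFin⁺ K))
    where
    hit : ∀ u i a → 2 ℕ.∸ δ u (leaf i a) ℕ.≤ (if does (target u i Fin.≟ a) then 2 else 0)
    hit (leaf j b) i a with j Fin.≟ i | b Fin.≟ a
    ... | yes _ | yes _ = ℕ.≤-refl
    ... | yes _ | no  _ = ℕ.z≤n
    ... | no  _ | yes _ = ℕ.z≤n
    ... | no  _ | no  _ = ℕ.z≤n
    hit (center y) i a with lookup y i Fin.≟ a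
    ... | yes _ = ℕ.s≤s ℕ.z≤n
    ... | no  _ = ℕ.z≤n

  open Capped δ public

  -- The offline optimum

  demand : Vec (Fin K) n → Fin n → Point
  demand x i = leaf i (lookup x i)

  -- Distinct leaves are at `δ` 2, and only demand `j` can coincide with `leaf j b`. By `c ≤ 2` all
  -- other demands contribute 0.
  gain-leaf : ∀ c j b x → c ℕ.≤ 2 → ∑ (allFin n) (λ i → c ℕ.∸ δ (leaf j b) (demand x i)) ℕ.≤ c
  gain-leaf c j b x c≤2 = ℕ.≤-trans (∑-mono (allFin n) own) (∑-indicator Fin._≟_ j c (allFin⁺ n))
    where
    own : ∀ i → c ℕ.∸ δ (leaf j b) (demand x i) ℕ.≤ (if does (j Fin.≟ i) then c else 0)
    own i with j Fin.≟ i | b Fin.≟ lookup x i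
    ... | yes _ | yes _ = ℕ.≤-refl
    ... | yes _ | no  _ = ℕ.m∸n≤m c 2
    ... | no  _ | yes _ = ℕ.≤-reflexive (ℕ.m≤n⇒m∸n≡0 c≤2)
    ... | no  _ | no  _ = ℕ.≤-reflexive (ℕ.m≤n⇒m∸n≡0 c≤2)

  leafWeight : Point → ℕ
  leafWeight (leaf _ _) = 1
  leafWeight (center _) = 0

  -- Under the cap 1 a center saves nothing, being at `δ` at least 1 from every leaf. A leaf saves
  -- only on the demand with its own index.
  1-gain : ∀ x u → ∑ (allFin n) (λ i → 1 ℕ.∸ δ u (demand x i)) ℕ.≤ leafWeight u
  1-gain x (leaf j b) = gain-leaf 1 j b x (ℕ.s≤s ℕ.z≤n)
  1-gain x (center y) = ℕ.≤-trans (∑-mono (allFin n) (λ i → ℕ.≤-reflexive (ℕ.m≤n⇒m∸n≡0 (1≤δ {center y} {demand x i} λ ()))))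
    (ℕ.≤-reflexive (trans (∑-const (allFin n) 0) (ℕ.*-zeroʳ (length (allFin n)))))

  2-gain : ∀ x {u} → leafWeight u ≡ 1 → ∑ (allFin n) (λ i → 2 ℕ.∸ δ u (demand x i)) ℕ.≤ 2
  2-gain x {leaf j b} _ = gain-leaf 2 j b x ℕ.≤-refl

  ∑-leafWeight≤length : ∀ F → ∑ F leafWeight ℕ.≤ length F
  ∑-leafWeight≤length F = ℕ.≤-trans (∑-mono F leafWeight≤1) (ℕ.≤-reflexive (trans (∑-const F 1) (ℕ.*-identityʳ (length F))))
    where
    leafWeight≤1 : ∀ u → leafWeight u ℕ.≤ 1
    leafWeight≤1 (leaf _ _) = ℕ.≤-refl
    leafWeight≤1 (center _) = ℕ.z≤n

  -- Each facility costs 2, which always covers its weight, and a center has weight 0. Hence one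
  -- center leaves its whole cost of 2 over after all weights are paid.
  all-leaves⊎center : ∀ F → All (λ u → leafWeight u ≡ 1) F ⊎ 2 ℕ.+ ∑ F leafWeight ℕ.≤ 2 ℕ.* length F
  all-leaves⊎center [] = inj₁ []
  all-leaves⊎center (center _ ∷ F) = inj₂ (ℕ.≤-trans
    (ℕ.+-monoʳ-≤ 2 (ℕ.≤-trans (∑-leafWeight≤length F) (ℕ.m≤n*m (length F) 2)))
    (ℕ.≤-reflexive (sym (ℕ.*-suc 2 (length F)))))
  all-leaves⊎center (leaf _ _ ∷ F) with all-leaves⊎center F
  ... | inj₁ leaves = inj₁ (refl ∷ leaves)
  ... | inj₂ h      = inj₂ (ℕ.≤-trans (ℕ.s≤s h) (ℕ.≤-trans (ℕ.n≤1+n _) (ℕ.≤-reflexive (sym (ℕ.*-suc 2 (length F))))))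

  length-allFin : ∀ k → length (allFin k) ≡ k
  length-allFin k = List.length-tabulate {n = k} _

  -- If all facilities are leaves, use the cap 2: each saves at most 2, its own price, so the total
  -- is at least `n * 2`. If there is a center, use the cap 1: leaves save at most 1 each and
  -- centers nothing, and by `all-leaves⊎center` the facility cost covers these savings and 2 more.
  opt-lower : ∀ x F → (n ℕ.* 2) ℕ.⊓ (2 ℕ.+ n) ℕ.≤ 2 ℕ.* length F ℕ.+ ∑ (allFin n) (λ i → cappedDist 2 F (demand x i))
  opt-lower x F with all-leaves⊎center F
  ... | inj₁ leaves = begin
    (n ℕ.* 2) ℕ.⊓ (2 ℕ.+ n)                                           ≤⟨ ℕ.m⊓n≤m _ _ ⟩
    n ℕ.* 2                                                           ≡⟨ cong (ℕ._* 2) (length-allFin n) ⟨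
    length (allFin n) ℕ.* 2                                           ≤⟨ ∑-cappedDist 2 F (allFin n) (demand x) ⟩
    D ℕ.+ ∑ F (λ u → ∑ (allFin n) (λ i → 2 ℕ.∸ δ u (demand x i)))     ≤⟨ ℕ.+-monoʳ-≤ D (∑-mono-All (All.map (λ {u} → 2-gain x {u}) leaves)) ⟩
    D ℕ.+ ∑ F (λ _ → 2)                                               ≡⟨ cong (D ℕ.+_) (∑-const F 2) ⟩
    D ℕ.+ length F ℕ.* 2                                              ≡⟨ lemma D (length F) ⟩
    2 ℕ.* length F ℕ.+ D                                              ∎
    where
    open ℕ.≤-Reasoning
    D = ∑ (allFin n) (λ i → cappedDist 2 F (demand x i))
    lemma : ∀ d l → d ℕ.+ l ℕ.* 2 ≡ 2 ℕ.* l ℕ.+ d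
    lemma = solve-∀
  ... | inj₂ 2+leaves≤ = begin
    (n ℕ.* 2) ℕ.⊓ (2 ℕ.+ n)                                           ≤⟨ ℕ.m⊓n≤n (n ℕ.* 2) _ ⟩
    2 ℕ.+ n                                                           ≡⟨ cong (2 ℕ.+_) (ℕ.*-identityʳ n) ⟨
    2 ℕ.+ n ℕ.* 1                                                     ≡⟨ cong (λ l → 2 ℕ.+ l ℕ.* 1) (length-allFin n) ⟨
    2 ℕ.+ length (allFin n) ℕ.* 1                                     ≤⟨ ℕ.+-monoʳ-≤ 2 (∑-cappedDist 1 F (allFin n) (demand x)) ⟩
    2 ℕ.+ (∑ (allFin n) (λ i → cappedDist 1 F (demand x i)) ℕ.+ ∑ F (λ u → ∑ (allFin n) (λ i → 1 ℕ.∸ δ u (demand x i))))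
      ≤⟨ ℕ.+-monoʳ-≤ 2 (ℕ.+-mono-≤ (∑-mono (allFin n) (λ i → cappedDist-mono F (demand x i) (ℕ.s≤s ℕ.z≤n))) (∑-mono F (1-gain x))) ⟩
    2 ℕ.+ (D ℕ.+ ∑ F leafWeight)                                      ≡⟨ lemma D (∑ F leafWeight) ⟩
    (2 ℕ.+ ∑ F leafWeight) ℕ.+ D                                      ≤⟨ ℕ.+-monoˡ-≤ D 2+leaves≤ ⟩
    2 ℕ.* length F ℕ.+ D                                              ∎
    where
    open ℕ.≤-Reasoning
    D = ∑ (allFin n) (λ i → cappedDist 2 F (demand x i))
    lemma : ∀ d l → 2 ℕ.+ (d ℕ.+ l) ≡ (2 ℕ.+ l) ℕ.+ d
    lemma = solve-∀

  -- The average online cost of a deterministic rule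

  vectors : List (Vec (Fin K) n)
  vectors = words (allFin K) n

  orders : List (List (Fin n))
  orders = permutations (allFin n)

  module _ (rule : List Point → List Point) where
    open Online rule

    -- The cap `2 * n` is the doubled form of truncating the cost at `n`.
    cappedCost : Vec (Fin K) n → List (Fin n) → ℕ
    cappedCost x σ = (2 ℕ.* n) ℕ.⊓ cost [] [] (map (demand x) σ)

    private
      lossOf : Vec (Fin K) n → List (Fin n) → ℕ
      lossOf x σ = losses n [] [] (map (demand x) σ)

    -- This is `cost+losses` for `m = n`: with no facilities and `n` arrivals to come, the potential
    -- starts at `2 * n`. The cap has the same value, so it does not weaken the bound.
    cappedCost+loss : ∀ x {σ} → length σ ≡ n → 2 ℕ.* n ℕ.≤ cappedCost x σ ℕ.+ lossOf x σ
    cappedCost+loss x {σ} |σ|≡n = begin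
      2 ℕ.* n                                              ≤⟨ ℕ.⊓-glb (ℕ.m≤m+n _ l) full ⟩
      (2 ℕ.* n ℕ.+ l) ℕ.⊓ (cost [] [] vs ℕ.+ l)            ≡⟨ ℕ.+-distribʳ-⊓ l (2 ℕ.* n) _ ⟨
      cappedCost x σ ℕ.+ l                                 ∎
      where
      open ℕ.≤-Reasoning
      l = lossOf x σ
      vs = map (demand x) σ
      full : 2 ℕ.* n ℕ.≤ cost [] [] vs ℕ.+ l
      full = subst (λ k → 2 ℕ.* k ℕ.≤ cost [] [] vs ℕ.+ l)
        (trans (cong (n ℕ.⊓_) (trans (List.length-map (demand x) σ) |σ|≡n)) (ℕ.⊓-idem n))
        (cost+losses n [] [] vs)

    -- In each of the `n` rounds the loss averages at most `n * 2 / K`. As `K` exceeds `n * n`, the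
    -- total average is at most 2.
    ∑-lossOf : ∀ {σ} → σ ↭ allFin n → ∑ vectors (λ x → lossOf x σ) ℕ.≤ length vectors ℕ.* 2
    ∑-lossOf {σ} σ↭ = ℕ.*-cancelˡ-≤ K (begin
      K ℕ.* ∑ vectors (λ x → lossOf x σ)                     ≡⟨ cong (ℕ._* ∑ vectors (λ x → lossOf x σ)) (length-allFin K) ⟨
      length (allFin K) ℕ.* ∑ vectors (λ x → lossOf x σ)     ≤⟨ ∑-losses n leaf one-hit unique (λ _ → []) (λ _ → []) (All.universal (λ _ _ _ → refl , refl) σ) ⟩
      length σ ℕ.* (length vectors ℕ.* (n ℕ.* 2))            ≡⟨ cong (ℕ._* (length vectors ℕ.* (n ℕ.* 2))) |σ|≡n ⟩
      n ℕ.* (length vectors ℕ.* (n ℕ.* 2))                   ≡⟨ lemma n (length vectors) ⟩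
      (n ℕ.* n) ℕ.* (length vectors ℕ.* 2)                   ≤⟨ ℕ.*-monoˡ-≤ (length vectors ℕ.* 2) (ℕ.n≤1+n (n ℕ.* n)) ⟩
      K ℕ.* (length vectors ℕ.* 2)                           ∎)
      where
      open ℕ.≤-Reasoning
      |σ|≡n : length σ ≡ n
      |σ|≡n = trans (↭.↭-length σ↭) (length-allFin n)
      unique : Unique σ
      unique = ↭ₛ.Unique-resp-↭ (setoid (Fin n)) (↭⇒↭ₛ (↭-sym σ↭)) (allFin⁺ n)
      lemma : ∀ n w → n ℕ.* (w ℕ.* (n ℕ.* 2)) ≡ (n ℕ.* n) ℕ.* (w ℕ.* 2)
      lemma = solve-∀

    -- For every order the losses average at most 2 over the vectors. Exchanging the two sums leaves
    -- an average of at least `2 * n ∸ 2` over all pairs of a vector and an order.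
    ∑-cappedCost : length vectors ℕ.* (length orders ℕ.* (2 ℕ.* n ℕ.∸ 2)) ℕ.≤ ∑ vectors (λ x → ∑ orders (cappedCost x))
    ∑-cappedCost = begin
      w ℕ.* (o ℕ.* (2 ℕ.* n ℕ.∸ 2))                        ≡⟨ ℕ.*-assoc w o _ ⟨
      w ℕ.* o ℕ.* (2 ℕ.* n ℕ.∸ 2)                          ≡⟨ ℕ.*-distribˡ-∸ (w ℕ.* o) (2 ℕ.* n) 2 ⟩
      w ℕ.* o ℕ.* (2 ℕ.* n) ℕ.∸ w ℕ.* o ℕ.* 2              ≤⟨ ℕ.m≤n+o⇒m∸n≤o _ _ total ⟩
      ∑ vectors (λ x → ∑ orders (cappedCost x))            ∎
      where
      open ℕ.≤-Reasoning
      w = length vectors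
      o = length orders
      lemma₁ : ∀ w o n → w ℕ.* o ℕ.* (2 ℕ.* n) ≡ w ℕ.* (o ℕ.* (2 ℕ.* n))
      lemma₁ = solve-∀
      lemma₂ : ∀ w o → o ℕ.* (w ℕ.* 2) ≡ w ℕ.* o ℕ.* 2
      lemma₂ = solve-∀
      S = ∑ vectors (λ x → ∑ orders (cappedCost x))
      total : w ℕ.* o ℕ.* (2 ℕ.* n) ℕ.≤ w ℕ.* o ℕ.* 2 ℕ.+ S
      total = begin
        w ℕ.* o ℕ.* (2 ℕ.* n)                                            ≡⟨ lemma₁ w o n ⟩
        w ℕ.* (o ℕ.* (2 ℕ.* n))                                          ≡⟨ ∑-const vectors _ ⟨
        ∑ vectors (λ _ → o ℕ.* (2 ℕ.* n))                                ≡⟨ ∑-cong vectors (λ _ → ∑-const orders _) ⟨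
        ∑ vectors (λ _ → ∑ orders (λ _ → 2 ℕ.* n))
          ≤⟨ ∑-mono vectors (λ x → ∑-mono-All (All.map (λ {σ} p → cappedCost+loss x {σ} (trans (↭.↭-length p) (length-allFin n))) (permutations-↭ (allFin n)))) ⟩
        ∑ vectors (λ x → ∑ orders (λ σ → cappedCost x σ ℕ.+ lossOf x σ)) ≡⟨ ∑-cong vectors (λ x → ∑-+ orders _ _) ⟩
        ∑ vectors (λ x → ∑ orders (cappedCost x) ℕ.+ ∑ orders (lossOf x)) ≡⟨ ∑-+ vectors _ _ ⟩
        S ℕ.+ ∑ vectors (λ x → ∑ orders (lossOf x))                      ≡⟨ cong (S ℕ.+_) (∑-swap vectors orders lossOf) ⟩
        S ℕ.+ ∑ orders (λ σ → ∑ vectors (λ x → lossOf x σ))              ≤⟨ ℕ.+-monoʳ-≤ S (∑-mono-All (All.map ∑-lossOf (permutations-↭ (allFin n)))) ⟩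
        S ℕ.+ ∑ orders (λ _ → w ℕ.* 2)                                   ≡⟨ cong (S ℕ.+_) (∑-const orders _) ⟩
        S ℕ.+ o ℕ.* (w ℕ.* 2)                                            ≡⟨ cong (S ℕ.+_) (lemma₂ w o) ⟩
        S ℕ.+ w ℕ.* o ℕ.* 2                                              ≡⟨ ℕ.+-comm S _ ⟩
        w ℕ.* o ℕ.* 2 ℕ.+ S                                              ∎

-- Rational and real arithmetic

fromℚᵘ-homo-+ : ∀ p q → ℚ.fromℚᵘ (p ℚᵘ.+ q) ≡ ℚ.fromℚᵘ p ℚ.+ ℚ.fromℚᵘ q
fromℚᵘ-homo-+ p q = ℚ.toℚᵘ-injective (begin-equality
  ℚ.toℚᵘ (ℚ.fromℚᵘ (p ℚᵘ.+ q))                          ≃⟨ ℚ.toℚᵘ-fromℚᵘ (p ℚᵘ.+ q) ⟩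
  p ℚᵘ.+ q                                              ≃⟨ ℚᵘ.+-cong (ℚ.toℚᵘ-fromℚᵘ p) (ℚ.toℚᵘ-fromℚᵘ q) ⟨
  ℚ.toℚᵘ (ℚ.fromℚᵘ p) ℚᵘ.+ ℚ.toℚᵘ (ℚ.fromℚᵘ q)          ≃⟨ ℚ.toℚᵘ-homo-+ (ℚ.fromℚᵘ p) (ℚ.fromℚᵘ q) ⟨
  ℚ.toℚᵘ (ℚ.fromℚᵘ p ℚ.+ ℚ.fromℚᵘ q)                    ∎)
  where open ℚᵘ.≤-Reasoning

fromℚᵘ-homo-* : ∀ p q → ℚ.fromℚᵘ (p ℚᵘ.* q) ≡ ℚ.fromℚᵘ p ℚ.* ℚ.fromℚᵘ q
fromℚᵘ-homo-* p q = ℚ.toℚᵘ-injective (begin-equality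
  ℚ.toℚᵘ (ℚ.fromℚᵘ (p ℚᵘ.* q))                          ≃⟨ ℚ.toℚᵘ-fromℚᵘ (p ℚᵘ.* q) ⟩
  p ℚᵘ.* q                                              ≃⟨ ℚᵘ.*-cong (ℚ.toℚᵘ-fromℚᵘ p) (ℚ.toℚᵘ-fromℚᵘ q) ⟨
  ℚ.toℚᵘ (ℚ.fromℚᵘ p) ℚᵘ.* ℚ.toℚᵘ (ℚ.fromℚᵘ q)          ≃⟨ ℚ.toℚᵘ-homo-* (ℚ.fromℚᵘ p) (ℚ.fromℚᵘ q) ⟨
  ℚ.toℚᵘ (ℚ.fromℚᵘ p ℚ.* ℚ.fromℚᵘ q)                    ∎)
  where open ℚᵘ.≤-Reasoning

fromℚᵘ-mono-≤ : ∀ {p q} → p ℚᵘ.≤ q → ℚ.fromℚᵘ p ℚ.≤ ℚ.fromℚᵘ q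
fromℚᵘ-mono-≤ {p} {q} p≤q = ℚ.toℚᵘ-cancel-≤ (begin
  ℚ.toℚᵘ (ℚ.fromℚᵘ p)   ≃⟨ ℚ.toℚᵘ-fromℚᵘ p ⟩
  p                     ≤⟨ p≤q ⟩
  q                     ≃⟨ ℚ.toℚᵘ-fromℚᵘ q ⟨
  ℚ.toℚᵘ (ℚ.fromℚᵘ q)   ∎)
  where open ℚᵘ.≤-Reasoning

ι : ℕ → ℚ
ι n = + n ℚ./ 1

ι-mono-≤ : ∀ {m n} → m ℕ.≤ n → ι m ℚ.≤ ι n
ι-mono-≤ {m} {n} m≤n = fromℚᵘ-mono-≤ {mkℚᵘ (+ m) 0} {mkℚᵘ (+ n) 0} (ℚᵘ.*≤* (ℤ.*-monoʳ-≤-nonNeg (+ 1) (ℤ.+≤+ m≤n)))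

ι-+ : ∀ m n → ι (m ℕ.+ n) ≡ ι m ℚ.+ ι n
ι-+ m n = trans
  (ℚ.fromℚᵘ-cong {mkℚᵘ (+ (m ℕ.+ n)) 0} {mkℚᵘ (+ m) 0 ℚᵘ.+ mkℚᵘ (+ n) 0}
    (ℚᵘ.*≡* (cong₂ (λ i j → (i ℤ.+ j) ℤ.* + 1) (sym (ℤ.*-identityʳ (+ m))) (sym (ℤ.*-identityʳ (+ n))))))
  (fromℚᵘ-homo-+ (mkℚᵘ (+ m) 0) (mkℚᵘ (+ n) 0))

ι-* : ∀ m n → ι (m ℕ.* n) ≡ ι m ℚ.* ι n
ι-* m n = trans
  (ℚ.fromℚᵘ-cong {mkℚᵘ (+ (m ℕ.* n)) 0} {mkℚᵘ (+ m) 0 ℚᵘ.* mkℚᵘ (+ n) 0}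
    (ℚᵘ.*≡* (cong (ℤ._* + 1) (ℤ.pos-* m n))))
  (fromℚᵘ-homo-* (mkℚᵘ (+ m) 0) (mkℚᵘ (+ n) 0))

/-*-ι : ∀ m d .{{_ : ℕ.NonZero d}} → (+ m ℚ./ d) ℚ.* ι d ≡ ι m
/-*-ι m (suc d) = trans (sym (fromℚᵘ-homo-* (mkℚᵘ (+ m) d) (mkℚᵘ (+ suc d) 0)))
  (ℚ.fromℚᵘ-cong {mkℚᵘ (+ m) d ℚᵘ.* mkℚᵘ (+ suc d) 0} {mkℚᵘ (+ m) 0}
    (ℚᵘ.*≡* (trans (ℤ.*-identityʳ _) (cong (λ e → + m ℤ.* + suc e) (sym (ℕ.*-identityʳ d))))))

-- Converts the integer costs, which are doubled, back to actual ones.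
half : ℕ → ℚ
half m = ½ ℚ.* ι m

half-mono-≤ : ∀ {m n} → m ℕ.≤ n → half m ℚ.≤ half n
half-mono-≤ m≤n = ℚ.*-monoˡ-≤-nonNeg ½ (ι-mono-≤ m≤n)

half-+ : ∀ m n → half (m ℕ.+ n) ≡ half m ℚ.+ half n
half-+ m n = trans (cong (½ ℚ.*_) (ι-+ m n)) (ℚ.*-distribˡ-+ ½ (ι m) (ι n))

half-2* : ∀ n → half (2 ℕ.* n) ≡ ι n
half-2* n = begin
  ½ ℚ.* ι (2 ℕ.* n)        ≡⟨ cong (½ ℚ.*_) (ι-* 2 n) ⟩
  ½ ℚ.* (ι 2 ℚ.* ι n)      ≡⟨ ℚ.*-assoc ½ (ι 2) (ι n) ⟨
  1ℚ ℚ.* ι n               ≡⟨ ℚ.*-identityˡ (ι n) ⟩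
  ι n                      ∎
  where open ≡-Reasoning

half-* : ∀ m n → half (m ℕ.* n) ≡ ι m ℚ.* half n
half-* m n = trans (cong (½ ℚ.*_) (ι-* m n)) (solve 3 (λ h a b → h :* (a :* b) := a :* (h :* b)) refl ½ (ι m) (ι n))
  where open +-*-Solver

p≤∣p∣ : ∀ p → p ℚ.≤ ℚ.∣ p ∣
p≤∣p∣ p with ℚ.≤-total 0ℚ p
... | inj₁ 0≤p = ℚ.≤-reflexive (sym (ℚ.0≤p⇒∣p∣≡p 0≤p))
... | inj₂ p≤0 = ℚ.≤-trans p≤0 (ℚ.0≤∣p∣ p)

q+[p-q]≡p : ∀ p q → q ℚ.+ (p ℚ.- q) ≡ p
q+[p-q]≡p = solve 2 (λ p q → q :+ (p :- q) := p) refl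
  where open +-*-Solver

∣-∣≤⇒≤+ : ∀ p q {ε} → ℚ.∣ p ℚ.- q ∣ ℚ.≤ ε → p ℚ.≤ q ℚ.+ ε
∣-∣≤⇒≤+ p q {ε} h = begin
  p                ≡⟨ q+[p-q]≡p p q ⟨
  q ℚ.+ (p ℚ.- q)  ≤⟨ ℚ.+-monoʳ-≤ q (ℚ.≤-trans (p≤∣p∣ _) h) ⟩
  q ℚ.+ ε          ∎
  where open ℚ.≤-Reasoning

p≤p+ε : ∀ p {ε} → 0ℚ ℚ.< ε → p ℚ.≤ p ℚ.+ ε
p≤p+ε p ε>0 = ℚ.≤-trans (ℚ.≤-reflexive (sym (ℚ.+-identityʳ p))) (ℚ.+-monoʳ-≤ p (ℚ.<⇒≤ ε>0))

p<q⇒0<q-p : ∀ {p q} → p ℚ.< q → 0ℚ ℚ.< q ℚ.- p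
p<q⇒0<q-p {p} {q} p<q = ℚ.≤-<-trans (ℚ.≤-reflexive (sym (ℚ.+-inverseʳ p))) (ℚ.+-monoˡ-< (ℚ.- p) p<q)

0<½ε : ∀ {ε} → 0ℚ ℚ.< ε → 0ℚ ℚ.< ½ ℚ.* ε
0<½ε {ε} ε>0 = ℚ.positive⁻¹ (½ ℚ.* ε) {{ℚ.pos*pos⇒pos ½ ε {{ℚ.positive ε>0}}}}

-- Order and averages of Cauchy reals

pointwise-≤ : ∀ {x y} → (∀ k → seq x k ℚ.≤ seq y k) → x ≤ y
pointwise-≤ {x} {y} x≤y ε ε>0 = 0 , λ k _ → ℚ.≤-trans (x≤y k) (p≤p+ε (seq y k) ε>0)

pointwise-≃ : ∀ {x y} → (∀ k → seq x k ≡ seq y k) → x ≃ y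
pointwise-≃ {x} {y} x≗y = pointwise-≤ {x} {y} (ℚ.≤-reflexive ∘ x≗y) , pointwise-≤ {y} {x} (ℚ.≤-reflexive ∘ sym ∘ x≗y)

≤-refl : ∀ {x} → x ≤ x
≤-refl {x} = pointwise-≤ {x} {x} (λ _ → ℚ.≤-refl)

≤-trans : ∀ {x y z} → x ≤ y → y ≤ z → x ≤ z
≤-trans {x} {y} {z} x≤y y≤z ε ε>0 with x≤y (½ ℚ.* ε) (0<½ε ε>0) | y≤z (½ ℚ.* ε) (0<½ε ε>0)
... | M , x≤ | N , y≤ = M ℕ.⊔ N , λ k k≥ → begin
  seq x k                                 ≤⟨ x≤ k (ℕ.m⊔n≤o⇒m≤o M N k≥) ⟩
  seq y k ℚ.+ ½ ℚ.* ε                     ≤⟨ ℚ.+-monoˡ-≤ (½ ℚ.* ε) (y≤ k (ℕ.m⊔n≤o⇒n≤o M N k≥)) ⟩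
  seq z k ℚ.+ ½ ℚ.* ε ℚ.+ ½ ℚ.* ε         ≡⟨ lemma (seq z k) ε ⟩
  seq z k ℚ.+ ε                           ∎
  where
  open ℚ.≤-Reasoning
  open +-*-Solver
  lemma : ∀ z ε → z ℚ.+ ½ ℚ.* ε ℚ.+ ½ ℚ.* ε ≡ z ℚ.+ ε
  lemma = solve 2 (λ z ε → z :+ con ½ :* ε :+ con ½ :* ε := z :+ ε) refl

≤-isPartialOrder : IsPartialOrder _≃_ _≤_
≤-isPartialOrder = record
  { isPreorder = record
    { isEquivalence = record
      { refl  = λ {x} → ≤-refl {x} , ≤-refl {x}
      ; sym   = λ (x≤y , y≤x) → y≤x , x≤y
      ; trans = λ {x} {y} {z} (x≤y , y≤x) (y≤z , z≤y) → ≤-trans {x} {y} {z} x≤y y≤z , ≤-trans {z} {y} {x} z≤y y≤x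
      }
    ; reflexive = proj₁
    ; trans     = λ {x} {y} {z} → ≤-trans {x} {y} {z}
    }
  ; antisym = _,_
  }

ℝ-poset : Poset 0ℓ 0ℓ 0ℓ
ℝ-poset = record { isPartialOrder = ≤-isPartialOrder }

module ≤-Reasoning = PosetReasoning ℝ-poset

+-mono-≤ : ∀ {w x y z} → w ≤ x → y ≤ z → w + y ≤ x + z
+-mono-≤ {w} {x} {y} {z} w≤x y≤z ε ε>0 with w≤x (½ ℚ.* ε) (0<½ε ε>0) | y≤z (½ ℚ.* ε) (0<½ε ε>0)
... | M , w≤ | N , y≤ = M ℕ.⊔ N , λ k k≥ → begin
  seq w k ℚ.+ seq y k                                     ≤⟨ ℚ.+-mono-≤ (w≤ k (ℕ.m⊔n≤o⇒m≤o M N k≥)) (y≤ k (ℕ.m⊔n≤o⇒n≤o M N k≥)) ⟩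
  (seq x k ℚ.+ ½ ℚ.* ε) ℚ.+ (seq z k ℚ.+ ½ ℚ.* ε)         ≡⟨ lemma (seq x k) (seq z k) ε ⟩
  seq x k ℚ.+ seq z k ℚ.+ ε                               ∎
  where
  open ℚ.≤-Reasoning
  open +-*-Solver
  lemma : ∀ x z ε → (x ℚ.+ ½ ℚ.* ε) ℚ.+ (z ℚ.+ ½ ℚ.* ε) ≡ x ℚ.+ z ℚ.+ ε
  lemma = solve 3 (λ x z ε → (x :+ con ½ :* ε) :+ (z :+ con ½ :* ε) := x :+ z :+ ε) refl

-- Take `η = ε / (1 + c)`; adding 1 avoids a division by zero.
shrink : ∀ {c ε} → 0ℚ ℚ.≤ c → 0ℚ ℚ.< ε → ∃[ η ] 0ℚ ℚ.< η × c ℚ.* η ℚ.≤ ε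
shrink {c} {ε} 0≤c ε>0 = η , ℚ.positive⁻¹ η , (begin
  c ℚ.* η                     ≤⟨ ℚ.*-monoʳ-≤-nonNeg η {{ℚ.pos⇒nonNeg η}} c≤1+c ⟩
  (1ℚ ℚ.+ c) ℚ.* η            ≡⟨ ℚ.*-assoc (1ℚ ℚ.+ c) r ε ⟨
  (1ℚ ℚ.+ c) ℚ.* r ℚ.* ε      ≡⟨ cong (ℚ._* ε) (ℚ.*-inverseʳ (1ℚ ℚ.+ c)) ⟩
  1ℚ ℚ.* ε                    ≡⟨ ℚ.*-identityˡ ε ⟩
  ε                           ∎)
  where
  open ℚ.≤-Reasoning
  instance
    1+c-pos : ℚ.Positive (1ℚ ℚ.+ c)
    1+c-pos = ℚ.pos+nonNeg⇒pos 1ℚ c {{ℚ.nonNegative 0≤c}}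
    1+c-nonZero : ℚ.NonZero (1ℚ ℚ.+ c)
    1+c-nonZero = ℚ.pos⇒nonZero (1ℚ ℚ.+ c)
  r η : ℚ
  r = ℚ.1/ (1ℚ ℚ.+ c)
  η = r ℚ.* ε
  instance
    η-pos : ℚ.Positive η
    η-pos = ℚ.pos*pos⇒pos r {{ℚ.1/pos⇒pos (1ℚ ℚ.+ c)}} ε {{ℚ.positive ε>0}}
  c≤1+c : c ℚ.≤ 1ℚ ℚ.+ c
  c≤1+c = ℚ.≤-trans (ℚ.≤-reflexive (sym (ℚ.+-identityˡ c))) (ℚ.+-monoˡ-≤ c (ℚ.<⇒≤ (ℚ.positive⁻¹ 1ℚ)))

*-monoˡ-≤ : ∀ {c x y} → 0ℚ ℚ.≤ c → x ≤ y → fromℚ c * x ≤ fromℚ c * y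
*-monoˡ-≤ {c} {x} {y} 0≤c x≤y ε ε>0 =
  let (η , η>0 , cη≤ε) = shrink 0≤c ε>0
      (N , x≤)         = x≤y η η>0
  in N , λ k k≥ → step (seq x k) (seq y k) cη≤ε (x≤ k k≥)
  where
  open ℚ.≤-Reasoning
  step : ∀ p q {η} → c ℚ.* η ℚ.≤ ε → p ℚ.≤ q ℚ.+ η → c ℚ.* p ℚ.≤ c ℚ.* q ℚ.+ ε
  step p q {η} cη≤ε p≤q+η = begin
    c ℚ.* p                  ≤⟨ ℚ.*-monoˡ-≤-nonNeg c {{ℚ.nonNegative 0≤c}} p≤q+η ⟩
    c ℚ.* (q ℚ.+ η)          ≡⟨ ℚ.*-distribˡ-+ c q η ⟩
    c ℚ.* q ℚ.+ c ℚ.* η      ≤⟨ ℚ.+-monoʳ-≤ (c ℚ.* q) cη≤ε ⟩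
    c ℚ.* q ℚ.+ ε            ∎

-- If `q < p`, then any `r` strictly between them gives a tolerance `r - q`, which would force
-- `p ≤ r`.
fromℚ-cancel-≤ : ∀ {p q} → fromℚ p ≤ fromℚ q → p ℚ.≤ q
fromℚ-cancel-≤ {p} {q} h = ℚ.≮⇒≥ λ q<p →
  let (r , q<r , r<p) = ℚ.<-dense q<p
      (N , p≤)        = h (r ℚ.- q) (p<q⇒0<q-p q<r)
  in ℚ.<-irrefl refl (ℚ.<-≤-trans r<p (ℚ.≤-trans (p≤ N ℕ.≤-refl) (ℚ.≤-reflexive (q+[p-q]≡p r q))))

-- Choose `m` strictly between `p` and `q`, and an index past which `r` varies by at most `m - p`
-- and `q - m`. Comparing the rational approximation of `r` at that index with `m` decides.
cotransitive : ∀ {p q} r → p ℚ.< q → fromℚ p ≤ r ⊎ r ≤ fromℚ q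
cotransitive {p} {q} r p<q =
  let (m , p<m , m<q) = ℚ.<-dense p<q
      (N₁ , close₁)   = cauchy r (m ℚ.- p) (p<q⇒0<q-p p<m)
      (N₂ , close₂)   = cauchy r (q ℚ.- m) (p<q⇒0<q-p m<q)
  in decide m N₁ N₂ close₁ close₂ (ℚ.≤-total m (seq r (N₁ ℕ.⊔ N₂)))
  where
  open ℚ.≤-Reasoning
  open +-*-Solver
  decide : ∀ m N₁ N₂ →
    (∀ j k → N₁ ℕ.≤ j → N₁ ℕ.≤ k → ℚ.∣ seq r j ℚ.- seq r k ∣ ℚ.≤ m ℚ.- p) →
    (∀ j k → N₂ ℕ.≤ j → N₂ ℕ.≤ k → ℚ.∣ seq r j ℚ.- seq r k ∣ ℚ.≤ q ℚ.- m) →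
    m ℚ.≤ seq r (N₁ ℕ.⊔ N₂) ⊎ seq r (N₁ ℕ.⊔ N₂) ℚ.≤ m → fromℚ p ≤ r ⊎ r ≤ fromℚ q
  decide m N₁ N₂ close₁ close₂ (inj₁ m≤a) = inj₁ λ ε ε>0 → N₁ , λ k k≥ → begin
    p                                ≡⟨ solve 2 (λ m p → p := m :+ (:- (m :- p))) refl m p ⟩
    m ℚ.+ ℚ.- (m ℚ.- p)              ≤⟨ ℚ.+-monoˡ-≤ (ℚ.- (m ℚ.- p)) (ℚ.≤-trans m≤a (∣-∣≤⇒≤+ (seq r (N₁ ℕ.⊔ N₂)) (seq r k) (close₁ _ k (ℕ.m≤m⊔n N₁ N₂) k≥))) ⟩
    seq r k ℚ.+ (m ℚ.- p) ℚ.+ ℚ.- (m ℚ.- p) ≡⟨ solve 2 (λ a d → a :+ d :+ (:- d) := a) refl (seq r k) (m ℚ.- p) ⟩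
    seq r k                          ≤⟨ p≤p+ε (seq r k) ε>0 ⟩
    seq r k ℚ.+ ε                    ∎
  decide m N₁ N₂ close₁ close₂ (inj₂ a≤m) = inj₂ λ ε ε>0 → N₂ , λ k k≥ → begin
    seq r k                          ≤⟨ ∣-∣≤⇒≤+ (seq r k) (seq r (N₁ ℕ.⊔ N₂)) (close₂ k _ k≥ (ℕ.m≤n⊔m N₁ N₂)) ⟩
    seq r (N₁ ℕ.⊔ N₂) ℚ.+ (q ℚ.- m)  ≤⟨ ℚ.+-monoˡ-≤ (q ℚ.- m) a≤m ⟩
    m ℚ.+ (q ℚ.- m)                  ≡⟨ q+[p-q]≡p q m ⟩
    q                                ≤⟨ p≤p+ε q ε>0 ⟩
    q ℚ.+ ε                          ∎

-- A finite search by `cotransitive`: either some value is found to be at least `p`, or every term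
-- is found to be at most `q`.
large-or-small : ∀ {p q} → p ℚ.< q → (f : A → ℝ) → ∀ xs →
  (∃[ x ] fromℚ p ≤ f x) ⊎ sumℝ (map f xs) ≤ fromℚ (ι (length xs) ℚ.* q)
large-or-small {q = q} p<q f [] = inj₂ (pointwise-≤ {0ℝ} {fromℚ (ι 0 ℚ.* q)} λ _ → ℚ.≤-reflexive (sym (ℚ.*-zeroˡ q)))
large-or-small {q = q} p<q f (x ∷ xs) with cotransitive (f x) p<q | large-or-small p<q f xs
... | inj₁ p≤fx | _      = inj₁ (x , p≤fx)
... | inj₂ _    | inj₁ h = inj₁ h
... | inj₂ fx≤q | inj₂ h = inj₂ (begin
  f x + sumℝ (map f xs)          ≤⟨ +-mono-≤ {f x} {fromℚ q} {sumℝ (map f xs)} {fromℚ (ι l ℚ.* q)} fx≤q h ⟩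
  fromℚ q + fromℚ (ι l ℚ.* q)    ≈⟨ pointwise-≃ {fromℚ q + fromℚ (ι l ℚ.* q)} {fromℚ (ι (suc l) ℚ.* q)} (λ _ → step) ⟩
  fromℚ (ι (suc l) ℚ.* q)        ∎)
  where
  l = length xs
  open ≤-Reasoning
  step : q ℚ.+ ι l ℚ.* q ≡ ι (suc l) ℚ.* q
  step = trans (solve 2 (λ l q → q :+ l :* q := (con 1ℚ :+ l) :* q) refl (ι l) q) (cong (ℚ._* q) (sym (ι-+ 1 l)))
    where open +-*-Solver

-- The order on ℝ is not decidable, whence the slack between p and q.
averaging : ∀ {p q} → p ℚ.< q → (f : A → ℝ) → ∀ xs → 0 ℕ.< length xs →
  fromℚ (ι (length xs) ℚ.* q) ≤ sumℝ (map f xs) → ∃[ x ] fromℚ p ≤ f x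
averaging {p = p} {q = q} p<q f xs 0<|xs| h =
  -- Searching with the threshold `m < q` makes failure contradictory: the sum would be at most
  -- `l * m`, which is strictly below `l * q` because the list is nonempty.
  let (m , p<m , m<q) = ℚ.<-dense p<q in by-cases m<q (large-or-small p<m f xs)
  where
  l = ι (length xs)
  by-cases : ∀ {m} → m ℚ.< q → (∃[ x ] fromℚ p ≤ f x) ⊎ sumℝ (map f xs) ≤ fromℚ (l ℚ.* m) → ∃[ x ] fromℚ p ≤ f x
  by-cases _ (inj₁ found) = found
  by-cases {m} m<q (inj₂ small) = contradiction refl (ℚ.<⇒≢ (ℚ.<-≤-trans
    (ℚ.*-monoʳ-<-pos l {{ℚ.positive (ℚ.<-≤-trans (ℚ.positive⁻¹ 1ℚ) (ι-mono-≤ 0<|xs|))}} m<q)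
    (fromℚ-cancel-≤ (≤-trans {fromℚ (l ℚ.* q)} {sumℝ (map f xs)} {fromℚ (l ℚ.* m)} h small))))

sumℝ-mono-≤ : ∀ {f g : A → ℝ} → (∀ x → f x ≤ g x) → ∀ xs → sumℝ (map f xs) ≤ sumℝ (map g xs)
sumℝ-mono-≤ f≤g []       = ≤-refl {0ℝ}
sumℝ-mono-≤ {f = f} {g} f≤g (x ∷ xs) =
  +-mono-≤ {f x} {g x} {sumℝ (map f xs)} {sumℝ (map g xs)} (f≤g x) (sumℝ-mono-≤ {f = f} {g} f≤g xs)

half-∑ : ∀ (xs : List A) (f : A → ℕ) (X : A → ℝ) k → (∀ a → half (f a) ℚ.≤ seq (X a) k) →
         half (∑ xs f) ℚ.≤ seq (sumℝ (map X xs)) k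
half-∑ []       f X k f≤X = ℚ.≤-refl
half-∑ (x ∷ xs) f X k f≤X = ℚ.≤-trans (ℚ.≤-reflexive (half-+ (f x) (∑ xs f))) (ℚ.+-mono-≤ (f≤X x) (half-∑ xs f X k f≤X))

-- Expectations of constants and finite sums

module _ (𝒫 : ProbabilitySpace) where
  open ProbabilitySpace 𝒫

  -- `E` takes a proof of integrability as an argument. Using `E-mono` in both directions passes
  -- from the given `i` to the proof for `fromℚ c * 1ℝ`, where `E-*` and `E-1` give the value.
  E-const : ∀ {c} → 0ℚ ℚ.≤ c → (i : Integrable (λ _ → fromℚ c)) → E _ i ≃ fromℚ c
  E-const {c} 0≤c i = upper , lower
    where
    open ≤-Reasoning
    u : Integrable (λ _ → 1ℝ)
    u = int-const 1ℝ
    cu : Integrable (λ _ → fromℚ c * 1ℝ)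
    cu = int-* (fromℚ c) u
    c≃c*1 : fromℚ c ≃ fromℚ c * 1ℝ
    c≃c*1 = pointwise-≃ {fromℚ c} {fromℚ c * 1ℝ} λ _ → sym (ℚ.*-identityʳ c)

    upper : E _ i ≤ fromℚ c
    upper = begin
      E _ i             ≤⟨ E-mono i cu (λ _ → proj₁ c≃c*1) ⟩
      E _ cu            ≈⟨ E-* (fromℚ c) u cu ⟩
      fromℚ c * E _ u   ≤⟨ *-monoˡ-≤ {c} {E _ u} {1ℝ} 0≤c (proj₁ (E-1 u)) ⟩
      fromℚ c * 1ℝ      ≈⟨ c≃c*1 ⟨
      fromℚ c           ∎

    lower : fromℚ c ≤ E _ i
    lower = begin
      fromℚ c           ≈⟨ c≃c*1 ⟩
      fromℚ c * 1ℝ      ≤⟨ *-monoˡ-≤ {c} {1ℝ} {E _ u} 0≤c (proj₂ (E-1 u)) ⟩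
      fromℚ c * E _ u   ≈⟨ E-* (fromℚ c) u cu ⟨
      E _ cu            ≤⟨ E-mono cu i (λ _ → proj₂ c≃c*1) ⟩
      E _ i             ∎

  module _ (X : A → Ω → ℝ) (i : ∀ a → Integrable (X a)) where

    int-sum : ∀ xs → Integrable (λ ω → sumℝ (map (λ a → X a ω) xs))
    int-sum []       = int-const 0ℝ
    int-sum (x ∷ xs) = int-+ (i x) (int-sum xs)

    E-sum-≤ : ∀ xs → E _ (int-sum xs) ≤ sumℝ (map (λ a → E (X a) (i a)) xs)
    E-sum-≤ []       = proj₁ (E-const {0ℚ} ℚ.≤-refl (int-const 0ℝ))
    E-sum-≤ (x ∷ xs) = begin
      E _ (int-sum (x ∷ xs))            ≈⟨ E-+ (i x) (int-sum xs) (int-sum (x ∷ xs)) ⟩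
      E (X x) (i x) + E _ (int-sum xs)  ≤⟨ +-mono-≤ {E (X x) (i x)} {E (X x) (i x)} {E _ (int-sum xs)} {s} (≤-refl {E (X x) (i x)}) (E-sum-≤ xs) ⟩
      E (X x) (i x) + s                 ∎
      where
      open ≤-Reasoning
      s = sumℝ (map (λ a → E (X a) (i a)) xs)

-- Costs of the hard instances

infix 4 _≼_

-- Bounds every term of the representing sequence, not only the limit, so that sums and minima
-- reduce to rational arithmetic term by term, without tolerances. The natural number is in the
-- doubled scale.
_≼_ : ℕ → ℝ∞ → Set
m ≼ fin x = ∀ k → half m ℚ.≤ seq x k
m ≼ ⊤⁺    = ⊤

≼-+ : ∀ {m n x y} → m ≼ x → n ≼ y → m ℕ.+ n ≼ x +∞ y
≼-+ {m} {n} {fin _} {fin _} m≼x n≼y k = ℚ.≤-trans (ℚ.≤-reflexive (half-+ m n)) (ℚ.+-mono-≤ (m≼x k) (n≼y k))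
≼-+ {x = fin _} {⊤⁺} _ _ = tt
≼-+ {x = ⊤⁺}         _ _ = tt

≼-⊓ : ∀ {m n x y} → m ≼ x → n ≼ y → m ℕ.⊓ n ≼ x ⊓∞ y
≼-⊓ {m} {n} {fin _} {fin _} m≼x n≼y k = ℚ.⊓-glb
  (ℚ.≤-trans (half-mono-≤ (ℕ.m⊓n≤m m n)) (m≼x k))
  (ℚ.≤-trans (half-mono-≤ (ℕ.m⊓n≤n m n)) (n≼y k))
≼-⊓ {m} {n} {fin _} {⊤⁺}    m≼x _   k = ℚ.≤-trans (half-mono-≤ (ℕ.m⊓n≤m m n)) (m≼x k)
≼-⊓ {m} {n} {⊤⁺}    {fin _} _   n≼y k = ℚ.≤-trans (half-mono-≤ (ℕ.m⊓n≤n m n)) (n≼y k)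
≼-⊓ {x = ⊤⁺}        {⊤⁺}    _   _     = tt

≼-fromℕ : ∀ l → 2 ℕ.* l ≼ fin (fromℕ l)
≼-fromℕ l k = ℚ.≤-reflexive (half-2* l)

≼-truncate : ∀ {m} N x → m ≼ x → ∀ k → half ((2 ℕ.* N) ℕ.⊓ m) ℚ.≤ seq (truncate N x) k
≼-truncate {m} N (fin x) m≼x k = ℚ.⊓-glb
  (ℚ.≤-trans (half-mono-≤ (ℕ.m⊓n≤n (2 ℕ.* N) m)) (m≼x k))
  (ℚ.≤-trans (half-mono-≤ (ℕ.m⊓n≤m (2 ℕ.* N) m)) (≼-fromℕ N k))
≼-truncate {m} N ⊤⁺ _ k = ℚ.≤-trans (half-mono-≤ (ℕ.m⊓n≤m (2 ℕ.* N) m)) (≼-fromℕ N k)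

≼⇒≤⁺ : ∀ {m x} → m ≼ x → fin (fromℚ (half m)) ≤⁺ x
≼⇒≤⁺ {m} {fin x} m≼x = fin≤ (pointwise-≤ {fromℚ (half m)} {x} m≼x)
≼⇒≤⁺ {m} {⊤⁺}    _   = fin (fromℚ (half m)) ≤⊤⁺

module HardInstances (n : ℕ) where
  open HiddenCenters n public

  space : MetricSpace
  space = record
    { Carrier  = Point
    ; _≈_      = _≡_
    ; d        = d
    ; isMetric = record
      { isSemiMetric = record
        { isQuasiSemiMetric = record
          { isPreMetric = record
            { isProtoMetric = record
              { isPartialOrder  = ≤-isPartialOrder
              ; ≈-isEquivalence = isEquivalence
              ; cong            = λ { {p} {_} {q} refl refl → pointwise-≃ {d p q} {d p q} λ _ → refl }
              ; nonNegative     = λ {p} {q} → pointwise-≤ {0ℝ} {d p q} λ _ → half-mono-≤ {0} {δ p q} ℕ.z≤n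
              }
            ; ≈⇒0 = λ { {p} refl → pointwise-≃ {d p p} {0ℝ} λ _ → cong half (δ-refl p) }
            }
          ; 0⇒≈ = λ {p} {q} → 0⇒≈ p q
          }
        ; sym = λ p q → pointwise-≃ {d p q} {d q p} λ _ → cong half (δ-sym p q)
        }
      ; triangle = λ p q r → pointwise-≤ {d p r} {d p q + d q r} λ _ →
          ℚ.≤-trans (half-mono-≤ {δ p r} {δ p q ℕ.+ δ q r} (δ-triangle p q r)) (ℚ.≤-reflexive (half-+ (δ p q) (δ q r)))
      }
    }
    where
    d : Point → Point → ℝ
    d p q = fromℚ (half (δ p q))
    0⇒≈ : ∀ p q → d p q ≃ 0ℝ → p ≡ q
    -- Equality of points is decidable, so it suffices to refute `p ≢ q`, in which case the distance
    -- is at least ½.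
    0⇒≈ p q (d≤0 , _) = decidable-stable (p ≟ q) λ p≢q → contradiction
      (ℚ.≤-trans (half-mono-≤ {1} {δ p q} (1≤δ p≢q)) (fromℚ-cancel-≤ {half (δ p q)} {0ℚ} d≤0))
      λ { (ℚ.*≤* (ℤ.+≤+ ())) }

  open MetricSpace space using (dist)

  instanceOf : Vec (Fin K) n → Instance n
  instanceOf x = record { space = space ; demands = demand x }

  cappedDist≼dist : ∀ F v → cappedDist 2 F v ≼ dist F v
  cappedDist≼dist []      v = tt
  cappedDist≼dist (u ∷ F) v = ≼-⊓ {δ u v} {cappedDist 2 F v} {fin _} {dist F v} (λ _ → ℚ.≤-refl) (cappedDist≼dist F v)

  cost≼costFrom : ∀ rule past F vs → Online.cost rule past F vs ≼ costFrom space rule past F vs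
  cost≼costFrom rule past F []       = ≼-fromℕ (length F)
  cost≼costFrom rule past F (v ∷ vs) =
    ≼-+ {cappedDist 2 F′ v} {_} {dist F′ v} (cappedDist≼dist F′ v) (cost≼costFrom rule past′ F′ vs)
    where
    past′ = past ∷ʳ v
    F′    = F ++ rule past′

  offlineCost-lower : ∀ x F → (n ℕ.* 2) ℕ.⊓ (2 ℕ.+ n) ≼ offlineCost (instanceOf x) F
  offlineCost-lower x F = ≼-mono {y = offlineCost (instanceOf x) F} (opt-lower x F)
    (≼-+ {2 ℕ.* length F} {_} {fin (fromℕ (length F))} (≼-fromℕ (length F)) (sum≼ (allFin n)))
    where
    ≼-mono : ∀ {m m′ y} → m ℕ.≤ m′ → m′ ≼ y → m ≼ y
    ≼-mono {y = fin _} m≤m′ m′≼y k = ℚ.≤-trans (half-mono-≤ m≤m′) (m′≼y k)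
    ≼-mono {y = ⊤⁺}    _    _      = tt
    sum≼ : ∀ is → ∑ is (λ i → cappedDist 2 F (demand x i)) ≼ foldr (λ i r → dist F (demand x i) +∞ r) (fin 0ℝ) is
    sum≼ []       k = ℚ.≤-refl
    sum≼ (i ∷ is)   = ≼-+ {cappedDist 2 F (demand x i)} {_} {dist F (demand x i)} (cappedDist≼dist F (demand x i)) (sum≼ is)

  offlineCost-single : ∀ x u → ∃[ y ] offlineCost (instanceOf x) (u ∷ []) ≡ fin y ×
    (∀ k → seq y k ≡ half (2 ℕ.+ ∑ (allFin n) (λ i → δ u (demand x i))))
  offlineCost-single x u =
    let (y , e , h) = sum≡ (allFin n)
    in fromℕ 1 + y , cong (fin (fromℕ 1) +∞_) e ,
       λ k → trans (cong (half 2 ℚ.+_) (h k)) (sym (half-+ 2 (∑ (allFin n) (λ i → δ u (demand x i)))))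
    where
    sum≡ : ∀ is → ∃[ y ] foldr (λ i r → dist (u ∷ []) (demand x i) +∞ r) (fin 0ℝ) is ≡ fin y ×
      (∀ k → seq y k ≡ half (∑ is (λ i → δ u (demand x i))))
    sum≡ []       = 0ℝ , refl , λ _ → refl
    sum≡ (i ∷ is) =
      let (y , e , h) = sum≡ is
          δᵢ          = δ u (demand x i)
      in fromℚ (half δᵢ) + y , cong (fin (fromℚ (half δᵢ)) +∞_) e ,
         λ k → trans (cong (half δᵢ ℚ.+_) (h k)) (sym (half-+ δᵢ (∑ is (λ i → δ u (demand x i)))))

  δ-own-center : ∀ x i → δ (center x) (demand x i) ≡ 1
  δ-own-center x i with lookup x i Fin.≟ lookup x i
  ... | yes _ = refl
  ... | no ¬p = contradiction refl ¬p

  module _ (ALG : Algorithm) where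
    open Algorithm ALG using (rule; measurable)

    private
      -- The space is the same for all `x`, hence so are the seed and, for each seed value, the
      -- rule: only the arrivals tell the algorithm about `x`.
      𝒫 : ProbabilitySpace
      𝒫 = Algorithm.seed ALG space

    open ProbabilitySpace 𝒫

    private
      vs : Vec (Fin K) n → List (Fin n) → List Point
      vs x σ = map (demand x) σ

      X : Vec (Fin K) n → List (Fin n) → Ω → ℝ
      X x σ ω = truncate n (onlineCost space (rule space ω) (vs x σ))

      X-int : ∀ x σ → Integrable (X x σ)
      X-int x σ = measurable space (vs x σ) n

      Y : Vec (Fin K) n → Ω → ℝ
      Y x ω = sumℝ (map (λ σ → X x σ ω) orders)

      Y-int : ∀ x → Integrable (Y x)
      Y-int x = int-sum 𝒫 (X x) (X-int x) orders

      EY : Vec (Fin K) n → ℝ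
      EY x = sumℝ (map (λ σ → E (X x σ) (X-int x σ)) orders)

      Q : ℕ
      Q = length orders ℕ.* (2 ℕ.* n ℕ.∸ 2)

    -- Yao's principle: for each seed value `ω` the rule is deterministic, and `∑-cappedCost` bounds
    -- its total over all vectors and orders. Taking the expectation and exchanging it with the
    -- finite sums gives the bound for the randomized algorithm.
    average : fromℚ (ι (length vectors) ℚ.* half Q) ≤ sumℝ (map EY vectors)
    average = begin
      fromℚ (ι (length vectors) ℚ.* half Q)               ≈⟨ pointwise-≃ {fromℚ (ι (length vectors) ℚ.* half Q)} {fromℚ M} (λ _ → sym (half-* (length vectors) Q)) ⟩
      fromℚ M                                             ≈⟨ E-const 𝒫 {M} (half-mono-≤ {0} {length vectors ℕ.* Q} ℕ.z≤n) (int-const (fromℚ M)) ⟨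
      E _ (int-const (fromℚ M))                           ≤⟨ E-mono (int-const (fromℚ M)) Z-int (λ ω → pointwise-≤ {fromℚ M} {Z ω} (M≤Z ω)) ⟩
      E Z Z-int                                           ≤⟨ E-sum-≤ 𝒫 Y Y-int vectors ⟩
      sumℝ (map (λ x → E (Y x) (Y-int x)) vectors)        ≤⟨ sumℝ-mono-≤ (λ x → E-sum-≤ 𝒫 (X x) (X-int x) orders) vectors ⟩
      sumℝ (map EY vectors)                               ∎
      where
      open ≤-Reasoning
      M : ℚ
      M = half (length vectors ℕ.* Q)
      Z : Ω → ℝ
      Z ω = sumℝ (map (λ x → Y x ω) vectors)
      Z-int : Integrable Z
      Z-int = int-sum 𝒫 Y Y-int vectors
      M≤Z : ∀ ω k → M ℚ.≤ seq (Z ω) k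
      M≤Z ω k = ℚ.≤-trans (half-mono-≤ (∑-cappedCost (rule space ω)))
        (half-∑ vectors _ (λ x → Y x ω) k λ x → half-∑ orders _ (λ σ → X x σ ω) k λ σ →
          ≼-truncate n (onlineCost space (rule space ω) (vs x σ)) (cost≼costFrom (rule space ω) [] [] (vs x σ)) k)

    hard-instance : ∃[ x ] fromℚ (half (2 ℕ.* n ℕ.∸ 2) ℚ.- 1ℚ) ≤ truncatedExpectedCost ALG (instanceOf x) n
    hard-instance = let (x , P≤EY) = averaging P<Q EY vectors vectors-nonempty average in x , (begin
      fromℚ (half (2 ℕ.* n ℕ.∸ 2) ℚ.- 1ℚ)       ≈⟨ pointwise-≃ {fromℚ (half (2 ℕ.* n ℕ.∸ 2) ℚ.- 1ℚ)} {fromℚ c * fromℚ P} (λ _ → rescale) ⟩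
      fromℚ c * fromℚ P                         ≤⟨ *-monoˡ-≤ {c} {fromℚ P} {EY x} 0≤c P≤EY ⟩
      fromℚ c * EY x                            ∎)
      where
      open ≤-Reasoning
      instance _ = n ℕ.!≢0
      c P o : ℚ
      c = + 1 ℚ./ n !
      o = ι (length orders)
      -- The strict gap required by `averaging`. One unit per order becomes exactly 1 after division
      -- by `n !`.
      P = half Q ℚ.- o

      |orders| : length orders ≡ n !
      |orders| = trans (length-permutations (allFin n)) (cong _! (length-allFin n))

      rescale : half (2 ℕ.* n ℕ.∸ 2) ℚ.- 1ℚ ≡ c ℚ.* P
      rescale = sym (E.begin
        c ℚ.* (half Q ℚ.- o)                     E.≡⟨ cong (λ h → c ℚ.* (h ℚ.- o)) (half-* (length orders) _) ⟩
        c ℚ.* (o ℚ.* h ℚ.- o)                    E.≡⟨ solve 3 (λ c o h → c :* (o :* h :- o) := (c :* o) :* (h :- con 1ℚ)) refl c o h ⟩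
        (c ℚ.* o) ℚ.* (h ℚ.- 1ℚ)                 E.≡⟨ cong (ℚ._* (h ℚ.- 1ℚ)) c*o≡1 ⟩
        1ℚ ℚ.* (h ℚ.- 1ℚ)                        E.≡⟨ ℚ.*-identityˡ _ ⟩
        h ℚ.- 1ℚ                                 E.∎)
        where
        module E = ≡-Reasoning
        open +-*-Solver
        h = half (2 ℕ.* n ℕ.∸ 2)
        c*o≡1 : c ℚ.* o ≡ 1ℚ
        c*o≡1 = trans (cong (λ l → c ℚ.* ι l) |orders|) (/-*-ι 1 (n !))

      0≤c : 0ℚ ℚ.≤ c
      0≤c = ℚ.nonNegative⁻¹ c {{ℚ.normalize-nonNeg 1 (n !)}}

      P<Q : P ℚ.< half Q
      P<Q = ℚ.<-≤-trans (ℚ.+-monoʳ-< (half Q) (ℚ.neg-antimono-< 0<o)) (ℚ.≤-reflexive (ℚ.+-identityʳ (half Q)))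
        where
        0<o : 0ℚ ℚ.< o
        0<o = ℚ.<-≤-trans (ℚ.positive⁻¹ 1ℚ) (ι-mono-≤ (subst (1 ℕ.≤_) (sym |orders|) (ℕ.>-nonZero⁻¹ (n !))))

      vectors-nonempty : 0 ℕ.< length vectors
      vectors-nonempty = subst (0 ℕ.<_)
        (sym (trans (length-words (allFin K) n) (cong (ℕ._^ n) (length-allFin K)))) (ℕ.m^n>0 K n)

-- The value of the optimum and the competitive ratio

2+n≤n*2 : ∀ k → 4 ℕ.+ k ℕ.≤ 4 ℕ.+ k ℕ.* 2
-- This is `2 + n ≤ n * 2` for `n = 2 + k`, with both sides computed.
2+n≤n*2 k = ℕ.+-monoʳ-≤ 4 (ℕ.m≤m*n k 2)

-- For `n = 1` the minimum is `n * 2`, reached by opening at the demand itself. From `n = 2` on it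
-- is `2 + n`, reached by the center `x`, which is at `δ` 1 from every demand.
opt-attained : ∀ n → 1 ℕ.≤ n → let open HardInstances n in
  ∀ x → ∃[ u ] 2 ℕ.+ ∑ (allFin n) (λ i → δ u (demand x i)) ≡ (n ℕ.* 2) ℕ.⊓ (2 ℕ.+ n)
opt-attained 1 _ x = demand x zero , cong (λ e → 2 ℕ.+ (e ℕ.+ 0)) (δ-refl (demand x zero))
  where open HardInstances 1
opt-attained n@(suc (suc k)) _ x = center x , (begin
  2 ℕ.+ ∑ (allFin n) (λ i → δ (center x) (demand x i))    ≡⟨ cong (2 ℕ.+_) (trans (∑-cong (allFin n) (δ-own-center x)) (∑-const (allFin n) 1)) ⟩
  2 ℕ.+ length (allFin n) ℕ.* 1                           ≡⟨ cong (2 ℕ.+_) (trans (ℕ.*-identityʳ _) (length-allFin n)) ⟩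
  2 ℕ.+ n                                                 ≡⟨ ℕ.m≥n⇒m⊓n≡n (2+n≤n*2 k) ⟨
  (n ℕ.* 2) ℕ.⊓ (2 ℕ.+ n)                                 ∎)
  where
  open HardInstances n
  open ≡-Reasoning

opt : ℕ → ℚ
opt n = half ((n ℕ.* 2) ℕ.⊓ (2 ℕ.+ n))

isOPT : ∀ n → 1 ℕ.≤ n → ∀ x → IsOPT (HardInstances.instanceOf n x) (fromℚ (opt n))
isOPT n 1≤n x = attained , λ F → ≼⇒≤⁺ {_} {offlineCost (instanceOf x) F} (offlineCost-lower x F)
  where
  open HardInstances n
  attained : ∃[ F ] offlineCost (instanceOf x) F ≃⁺ fin (fromℚ (opt n))
  attained =
    let (u , cost≡opt)           = opt-attained n 1≤n x
        (y , offlineCost≡y , y≡) = offlineCost-single x u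
    in u ∷ [] , subst (_≃⁺ fin (fromℚ (opt n))) (sym offlineCost≡y)
         (fin≃ (pointwise-≃ {y} {fromℚ (opt n)} λ k → trans (y≡ k) (cong half cost≡opt)))

-- For n ≥ 2 this makes (2 - deficit n) · OPT = n - 3, and it is large enough
-- for n = 1, where OPT = 1 rather than 1 + n/2.
deficit : ℕ → ℚ
deficit n = + 10 ℚ./ (2 ℕ.+ n)

deficit⟶0 : (λ n → fromℚ (deficit n)) ⟶ 0ℝ
deficit⟶0 ε ε>0 = N ε , λ n n≥N →
    pointwise-≤ {fromℚ (deficit n)} {0ℝ + fromℚ ε} (λ _ → ℚ.≤-trans (small ε ε>0 n n≥N) (ℚ.≤-reflexive (sym (ℚ.+-identityˡ ε))))
  , pointwise-≤ {0ℝ} {fromℚ (deficit n) + fromℚ ε} (λ _ → ℚ.≤-trans (0≤deficit n) (p≤p+ε (deficit n) ε>0))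
  where
  N : ℚ → ℕ
  -- A positive `ε` is at least 1 over its denominator, so `10 / (2 + n)` is at most `ε` from this
  -- index on.
  N ε = 10 ℕ.* ℚ.↧ₙ ε
  0≤deficit : ∀ n → 0ℚ ℚ.≤ deficit n
  0≤deficit n = ℚ.nonNegative⁻¹ (deficit n) {{ℚ.normalize-nonNeg 10 (2 ℕ.+ n)}}
  small : ∀ ε → 0ℚ ℚ.< ε → ∀ n → N ε ℕ.≤ n → deficit n ℚ.≤ ε
  small ε@(mkℚ +[1+ m ] d _) _ n n≥N = subst (deficit n ℚ.≤_) (ℚ.fromℚᵘ-toℚᵘ ε)
    (fromℚᵘ-mono-≤ {mkℚᵘ (+ 10) (suc n)} {mkℚᵘ +[1+ m ] d} (ℚᵘ.*≤* (ℤ.+≤+ (begin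
      10 ℕ.* suc d              ≤⟨ n≥N ⟩
      n                         ≤⟨ ℕ.m≤n+m n 2 ⟩
      2 ℕ.+ n                   ≤⟨ ℕ.m≤n*m (2 ℕ.+ n) (suc m) ⟩
      suc m ℕ.* (2 ℕ.+ n)       ∎))))
    where open ℕ.≤-Reasoning
  small (mkℚ (+ 0)     _ _) (ℚ.*<* (ℤ.+<+ ()))
  small (mkℚ -[1+ _ ]  _ _) (ℚ.*<* ())

-- The right side is `n - 2`: the average `n - 1` less the gap spent in `hard-instance`. The left
-- side is `n - 3` for `n ≥ 2`; for `n = 1` the claim is `-4/3 ≤ -1`.
ratio-bound : ∀ n → 1 ℕ.≤ n → (ι 2 ℚ.- deficit n) ℚ.* opt n ℚ.≤ half (2 ℕ.* n ℕ.∸ 2) ℚ.- 1ℚ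
ratio-bound 1 _ = ℚ.≤ᵇ⇒≤ tt
ratio-bound n@(suc (suc k)) _ = begin
  (ι 2 ℚ.- r) ℚ.* opt n                               ≡⟨ cong (λ m → (ι 2 ℚ.- r) ℚ.* half m) (ℕ.m≥n⇒m⊓n≡n (2+n≤n*2 k)) ⟩
  (ι 2 ℚ.- r) ℚ.* (½ ℚ.* m)                           ≡⟨ solve 2 (λ r m → (con (ι 2) :- r) :* (con ½ :* m) := m :- con ½ :* (r :* m)) refl r m ⟩
  m ℚ.- ½ ℚ.* (r ℚ.* m)                               ≡⟨ cong (λ t → m ℚ.- ½ ℚ.* t) (/-*-ι 10 (2 ℕ.+ n)) ⟩
  m ℚ.- ½ ℚ.* ι 10                                    ≡⟨ cong (λ t → t ℚ.- ½ ℚ.* ι 10) (ι-+ 3 (suc k)) ⟩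
  ι 3 ℚ.+ ι (suc k) ℚ.- ½ ℚ.* ι 10                    ≡⟨ solve 1 (λ s → con (ι 3) :+ s :- con ½ :* con (ι 10) := s :- con (ι 2)) refl (ι (suc k)) ⟩
  ι (suc k) ℚ.- ι 2                                   ≤⟨ ℚ.+-monoʳ-≤ (ι (suc k)) (ℚ.neg-antimono-≤ (ι-mono-≤ {1} {2} (ℕ.s≤s ℕ.z≤n))) ⟩
  ι (suc k) ℚ.- 1ℚ                                    ≡⟨ cong (ℚ._- 1ℚ) (half-2* (suc k)) ⟨
  half (2 ℕ.* suc k) ℚ.- 1ℚ                           ≡⟨ cong (λ m → half m ℚ.- 1ℚ) (lemma k) ⟨
  half (2 ℕ.* n ℕ.∸ 2) ℚ.- 1ℚ                         ∎
  where
  open ℚ.≤-Reasoning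
  open +-*-Solver
  r m : ℚ
  r = deficit n
  m = ι (2 ℕ.+ n)
  lemma : ∀ k → 2 ℕ.* (2 ℕ.+ k) ℕ.∸ 2 ≡ 2 ℕ.* suc k
  lemma k = cong (ℕ._∸ 2) (ℕ.*-suc 2 (suc k))

corollary5p2 : (ALG : Algorithm) →
    Σ[ I ∈ ((n : ℕ) → Instance n) ] Σ[ δ ∈ (ℕ → ℝ) ] δ ⟶ 0ℝ ×
    ((n : ℕ) → 1 ℕ.≤ n →
    ∃[ OPT ] IsOPT (I n) OPT × ExpectedCostAtLeast ALG (I n) ((2ℝ - δ n) * OPT))
corollary5p2 ALG = I , (λ n → fromℚ (deficit n)) , deficit⟶0 ,
  -- The bound already holds for the cost truncated at `n`, so the level `n` serves for every `ε`.
  λ n 1≤n → fromℚ (opt n) , isOPT n 1≤n (x n) , λ ε ε>0 → n , lower-bound n 1≤n ε ε>0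
  where
  open HardInstances
  open ≤-Reasoning
  x : ∀ n → Vec (Fin (K n)) n
  x n = proj₁ (hard-instance n ALG)
  I : ∀ n → Instance n
  I n = instanceOf n (x n)
  lower-bound : ∀ n → 1 ℕ.≤ n → ∀ ε → 0ℚ ℚ.< ε →
    (2ℝ - fromℚ (deficit n)) * fromℚ (opt n) ≤ truncatedExpectedCost ALG (I n) n + fromℚ ε
  lower-bound n 1≤n ε ε>0 = begin
    (2ℝ - fromℚ (deficit n)) * fromℚ (opt n)      ≤⟨ pointwise-≤ {(2ℝ - fromℚ (deficit n)) * fromℚ (opt n)} {fromℚ p} (λ _ → ratio-bound n 1≤n) ⟩
    fromℚ p                                       ≤⟨ proj₂ (hard-instance n ALG) ⟩
    t                                             ≤⟨ pointwise-≤ {t} {t + fromℚ ε} (λ k → p≤p+ε (seq t k) ε>0) ⟩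
    t + fromℚ ε                                   ∎
    where
    p : ℚ
    p = half (2 ℕ.* n ℕ.∸ 2) ℚ.- 1ℚ
    t : ℝ
    t = truncatedExpectedCost ALG (I n) n
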